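{- There is an algorithm that solves the Group Steiner Tree problem in $O(2^{l}\cdot n^{O(1)})$ time using polynomial space, where $l$ is the number of given vertex subsets and $n$ is the total input size.
   Context: Group Steiner Tree is the following decision problem. Input: an undirected graph $G=(V,E)$, vertex-disjoint subsets $S_1,\ldots,S_l\subseteq V$, and an integer $p$. Question: does $G$ contain (as a subgraph) a tree on at most $p$ vertices that includes at least one vertex from each $S_i$, $1\le i\le l$? -}

module Defs where

open import Data.Bool.Base using (Bool; true; false; T; if_then_else_)
open import Data.Fin.Base using (Fin)
open import Data.Fin.Subset using (Subset; _∈_; _∩_; ∣_∣; Nonempty; Empty)
open import Data.Integer.Base as ℤ using (ℤ; +_; -[1+_])
open import Data.List.Base as List using (List; []; _∷_; _++_; _∷ʳ_; length)
open import Data.List.Relation.Unary.Linked using (Linked)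
open import Data.List.Relation.Unary.Unique.Propositional using (Unique)
open import Data.Nat.Base using (ℕ; zero; suc; _+_; _∸_; _*_; _/_; _⊔_; _≤_)
open import Data.Nat.ListAction using (sum)
open import Data.Nat.Logarithm using (⌊log₂_⌋)
open import Data.Product.Base using (_×_; _,_; ∃-syntax)
open import Data.Vec.Base using (lookup)
open import Relation.Binary.Construct.Closure.ReflexiveTransitive using (Star)
open import Relation.Binary.PropositionalEquality.Core using (_≡_; _≢_)
open import Relation.Nullary.Negation.Core using (¬_)

record Graph (n : ℕ) : Set where
  field
    edge    : Fin n → Fin n → Bool
    symm    : ∀ {u v} → T (edge u v) → T (edge v u)
    irrefl  : ∀ {u} → ¬ T (edge u u)

record Subgraph {n : ℕ} (G : Graph n) : Set where
  field
    verts     : Subset n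
    edge      : Fin n → Fin n → Bool
    symm      : ∀ {u v} → T (edge u v) → T (edge v u)
    edge⊆     : ∀ {u v} → T (edge u v) → T (Graph.edge G u v)
    endpoints : ∀ {u v} → T (edge u v) → u ∈ verts × v ∈ verts

  Adj : Fin n → Fin n → Set
  Adj u v = T (edge u v)

  Connected : Set
  Connected = ∀ {u v} → u ∈ verts → v ∈ verts → Star Adj u v

  -- The cycle visits the distinct vertices u ∷ vs, at least three of them,
  -- and returns to u.
  IsCycle : Fin n → List (Fin n) → Set
  IsCycle u vs = 2 ≤ length vs × Unique (u ∷ vs) × Linked Adj ((u ∷ vs) ∷ʳ u)

  Acyclic : Set
  Acyclic = ∀ u vs → ¬ IsCycle u vs

  IsTree : Set
  IsTree = Nonempty verts × Connected × Acyclic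

record Instance : Set where
  field
    order    : ℕ
    graph    : Graph order
    l        : ℕ
    group    : Fin l → Subset order
    disjoint : ∀ {i j} → i ≢ j → Empty (group i ∩ group j)
    p        : ℤ

HasGroupSteinerTree : Instance → Set
HasGroupSteinerTree I =
  ∃[ H ] Subgraph.IsTree {G = graph} H
       × (+ ∣ Subgraph.verts H ∣) ℤ.≤ p
       × (∀ i → Nonempty (Subgraph.verts H ∩ group i))
  where open Instance I

-- Random access machine with logarithmic cost (Aho, Hopcroft, Ullman),
-- over natural numbers and with structured control flow.  The input is a
-- read-only array; the work memory is initially empty and is the only
-- memory charged for space.

-- Number of binary digits, with len 0 = 1.
len : ℕ → ℕ
len x = suc ⌊log₂ x ⌋

totalLen : List ℕ → ℕ
totalLen xs = sum (List.map len xs)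

-- Cell a of the work memory is the a-th entry of the list; cells beyond its
-- end hold 0.
Memory : Set
Memory = List ℕ

read : List ℕ → ℕ → ℕ
read []       _       = 0
read (x ∷ _)  zero    = x
read (_ ∷ xs) (suc a) = read xs a

-- Writing beyond the end pads with zeros, so that every cell below the
-- highest one written is charged for space.
write : Memory → ℕ → ℕ → Memory
write []       zero    y = y ∷ []
write []       (suc a) y = 0 ∷ write [] a y
write (_ ∷ xs) zero    y = y ∷ xs
write (x ∷ xs) (suc a) y = x ∷ write xs a y

data Operand : Set where
  const  : ℕ → Operand   -- the literal k
  reg    : ℕ → Operand   -- the content of cell r
  ind    : ℕ → Operand   -- the content of the cell whose address is in cell r
  input  : ℕ → Operand   -- the input entry whose index is in cell r

data Dest : Set where
  reg ind : ℕ → Dest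

data Op : Set where
  add sub mul div : Op

infix  6 _≔_⟨_⟩_
infixr 5 _⨾_

data Program : Set where
  skip            : Program
  _≔_⟨_⟩_         : Dest → Operand → Op → Operand → Program
  _⨾_             : Program → Program → Program
  ifnz_then_else_ : Operand → Program → Program → Program
  whilenz_loop_   : Operand → Program → Program

-- Subtraction is truncated and division by zero gives zero.
apply : Op → ℕ → ℕ → ℕ
apply add x y       = x + y
apply sub x y       = x ∸ y
apply mul x y       = x * y
apply div x zero    = 0
apply div x (suc y) = x / suc y

module Semantics (inp : List ℕ) where

  value : Memory → Operand → ℕ
  value m (const k) = k
  value m (reg r)   = read m r
  value m (ind r)   = read m (read m r)
  value m (input r) = read inp (read m r)

  operandCost : Memory → Operand → ℕ
  operandCost m (const k)   = len k
  operandCost m (reg r)     = len r + len (read m r)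
  operandCost m o@(ind r)   = len r + len (read m r) + len (value m o)
  operandCost m o@(input r) = len r + len (read m r) + len (value m o)

  address : Memory → Dest → ℕ
  address m (reg r) = r
  address m (ind r) = read m r

  destCost : Memory → Dest → ℕ
  destCost m (reg r) = len r
  destCost m (ind r) = len r + len (read m r)

  update : Memory → Dest → Operand → Op → Operand → Memory
  update m d x o y = write m (address m d) (apply o (value m x) (value m y))

  -- Run P m m′ t s: started in memory m, the program P halts in memory m′
  -- after time t, and s is the largest size of the memory along the way.
  -- The rules are syntax-directed, so P and m determine m′, t and s.
  data Run : Program → Memory → Memory → (t s : ℕ) → Set where

    skip : ∀ {m} → Run skip m m 1 (totalLen m)

    assign : ∀ {m d x o y} → let m′ = update m d x o y in
      Run (d ≔ x ⟨ o ⟩ y) m m′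
          (destCost m d + operandCost m x + operandCost m y)
          (totalLen m ⊔ totalLen m′)

    seq : ∀ {P Q m₁ m₂ m₃ t₁ t₂ s₁ s₂} →
      Run P m₁ m₂ t₁ s₁ → Run Q m₂ m₃ t₂ s₂ →
      Run (P ⨾ Q) m₁ m₃ (t₁ + t₂) (s₁ ⊔ s₂)

    if-nonzero : ∀ {x P Q m m′ t s} →
      value m x ≢ 0 → Run P m m′ t s →
      Run (ifnz x then P else Q) m m′ (operandCost m x + t) s

    if-zero : ∀ {x P Q m m′ t s} →
      value m x ≡ 0 → Run Q m m′ t s →
      Run (ifnz x then P else Q) m m′ (operandCost m x + t) s

    while-zero : ∀ {x P m} →
      value m x ≡ 0 →
      Run (whilenz x loop P) m m (operandCost m x) (totalLen m)

    while-nonzero : ∀ {x P m₁ m₂ m₃ t₁ t₂ s₁ s₂} →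
      value m₁ x ≢ 0 → Run P m₁ m₂ t₁ s₁ →
      Run (whilenz x loop P) m₂ m₃ t₂ s₂ →
      Run (whilenz x loop P) m₁ m₃ (operandCost m₁ x + t₁ + t₂) (s₁ ⊔ s₂)

open Semantics public using (Run)

bit : Bool → ℕ
bit b = if b then 1 else 0

matrix : ∀ {m n} → (Fin m → Fin n → Bool) → List ℕ
matrix f = List.concat (List.tabulate λ i → List.tabulate λ j → bit (f i j))

signBit : ℤ → ℕ
signBit (+ _)    = 0
signBit -[1+ _ ] = 1

-- The adjacency matrix of the graph and the incidence matrix of the groups,
-- preceded by the numbers of vertices and groups and by p.
encode : Instance → List ℕ
encode I = order ∷ l ∷ signBit p ∷ ℤ.∣ p ∣ ∷
           matrix (Graph.edge graph) ++ matrix (λ i v → lookup (group i) v)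
  where open Instance I

inputSize : Instance → ℕ
inputSize I = totalLen (encode I)

{-# OPTIONS --safe #-}

-- A Steiner tree on at most p vertices exists iff some branching walk (a rooted
-- tree mapped homomorphically into G) of size at most p′ = min(p, n) meets every
-- group.  For a set X of groups, the walks from v that avoid X are counted by
-- W(v) = a(v) (M + W(v) Σ W(u)), where u ranges over the neighbours of v, a is the
-- indicator of avoiding X and a walk of size j has weight M ^ j.  All arithmetic is
-- modulo N = M ^ (p′ + 1), which removes the walks of size above p′, so p′ rounds of
-- the recursion suffice and all numbers stay polynomially long.  Summing over the X
-- with signs ± 1 (− 1 being N − 1) leaves the total weight of the walks that meet
-- every group.  A Kraft inequality shows that there are fewer than M = (4n) ^ p′ walks
-- of size at most p′, so this total is below N and its residue is 0 only if it is 0.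

module Submission where

open import Defs
open import Data.Bool.Base using (Bool; true; false; T)
open import Data.Bool.Properties using (T?)
open import Data.Empty using (⊥-elim)
open import Data.Fin.Base using (Fin; zero; suc; toℕ; fromℕ<)
open import Data.Fin.Properties using (any?; toℕ<n; toℕ-fromℕ<) renaming (_≟_ to _≟ᶠ_)
open import Data.Fin.Subset using (Subset; _∈_; _∉_; _⊆_; _∪_; ⁅_⁆; ∣_∣; Nonempty; outside; inside)
open import Data.Fin.Subset.Properties using (_∈?_; x∈⁅x⁆; x∈⁅y⁆⇒x≡y; x∈p∪q⁺; x∈p∪q⁻; p⊆q⇒∣p∣≤∣q∣; p⊂q⇒∣p∣<∣q∣; ∣⁅x⁆∣≡1; ∣p∣≤n; p⊆p∪q; ∪-identityʳ; x∈p∩q⁺; x∈p∩q⁻)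
open import Data.Integer.Base as ℤ using (-[1+_]; +≤+)
open import Data.Integer.Properties using (drop‿+≤+)
open import Data.List.Base using (List; []; _∷_; _++_; _∷ʳ_; cartesianProductWith; downFrom; length; map; tabulate)
open import Data.List.Membership.Propositional using () renaming (_∈_ to _∈ˡ_)
open import Data.List.Membership.Propositional.Properties using (∈-++⁺ˡ; ∈-++⁺ʳ; ∈-cartesianProductWith⁺)
open import Data.List.Properties using (length-tabulate; length-++; ++-assoc; ++-identityʳ)
open import Data.List.Relation.Unary.All as All using (All; []; _∷_)
import Data.List.Relation.Unary.All.Properties as Allₚ
open import Data.List.Relation.Unary.AllPairs using (_∷_)
open import Data.List.Relation.Unary.Any using (here; there)
open import Data.List.Relation.Unary.Linked using (Linked; [-]; _∷_)
open import Data.List.Relation.Unary.Unique.Propositional using (Unique)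
open import Data.Nat.Base
open import Data.Nat.DivMod hiding (_div_)
open import Data.Nat.Logarithm using (⌊log₂⌋-mono-≤; ⌊log₂[2^n]⌋≡n)
open import Data.Nat.Properties
open import Data.Nat.Tactic.RingSolver using (solve-∀)
open import Data.Product.Base using (_×_; _,_; ∃-syntax; proj₁; proj₂)
open import Data.Sum.Base using (_⊎_; inj₁; inj₂)
open import Data.Unit.Base using (⊤; tt)
open import Data.Vec.Base using (lookup; []; _∷_)
open import Data.Vec.Properties using ([]=⇒lookup; lookup⇒[]=)
open import Function.Bundles using (_⇔_; mk⇔)
open import Relation.Binary.Construct.Closure.ReflexiveTransitive as Star using (Star; ε; _◅_; _◅◅_)
open import Relation.Binary.PropositionalEquality
open import Relation.Nullary using (Dec; yes; no; ¬_; ¬?; _×-dec_; _⊎-dec_)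
open import Relation.Nullary.Decidable using (⌊_⌋; toWitness; fromWitness)

-- Running times of programs

-- Polynomial space rules out dynamic programming over sets of groups, which would keep a value for
-- each of the 2 ^ l sets. Inclusion-exclusion treats the sets X one after another and needs only n
-- numbers at a time. It requires counting, and trees, whose vertices must be distinct, satisfy no
-- local recursion. Walks do, and nothing is lost: a connected subgraph has a walk through all its
-- vertices no larger than itself, and the vertices of a walk carry a tree no larger than the walk.
-- Powers of M pack the counts for all sizes into one number per vertex, so the table needs no size
-- index. The table is updated in place, so after some updates a cell does not count the walks of
-- any fixed height. The proof therefore follows the exact lists of walks that the updates generate.
-- These lists are the same for every X and every graph on n vertices; edges and avoided groups
-- enter only as 0/1 factors of a walk's weight. Two properties of the lists carry the argument:
-- every small walk occurs in them, and the Kraft bound survives each single update.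

len-mono : ∀ x {y} → x ≤ y → len x ≤ len y
len-mono x x≤y = s≤s (⌊log₂⌋-mono-≤ x≤y)

read-write-≡ : ∀ m a y → read (write m a y) a ≡ y
read-write-≡ []      zero    y = refl
read-write-≡ []      (suc a) y = read-write-≡ [] a y
read-write-≡ (_ ∷ m) zero    y = refl
read-write-≡ (_ ∷ m) (suc a) y = read-write-≡ m a y

read-write-≢ : ∀ m {a b} y → a ≢ b → read (write m a y) b ≡ read m b
read-write-≢ m       {zero}  {zero}  y a≢b = ⊥-elim (a≢b refl)
read-write-≢ []      {zero}  {suc b} y a≢b = refl
read-write-≢ (_ ∷ m) {zero}  {suc b} y a≢b = refl
read-write-≢ []      {suc a} {zero}  y a≢b = refl
read-write-≢ []      {suc a} {suc b} y a≢b = read-write-≢ [] y (λ e → a≢b (cong suc e))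
read-write-≢ (_ ∷ m) {suc a} {zero}  y a≢b = refl
read-write-≢ (_ ∷ m) {suc a} {suc b} y a≢b = read-write-≢ m y (λ e → a≢b (cong suc e))

All-write : ∀ {B m y} a → All (_≤ B) m → y ≤ B → All (_≤ B) (write m a y)
All-write zero    []         y≤B = y≤B ∷ []
All-write (suc a) []         y≤B = z≤n ∷ All-write a [] y≤B
All-write zero    (_ ∷ m≤B)  y≤B = y≤B ∷ m≤B
All-write (suc a) (x≤B ∷ m≤B) y≤B = x≤B ∷ All-write a m≤B y≤B

read-≤ : ∀ {B m} → All (_≤ B) m → ∀ a → read m a ≤ B
read-≤ []          a       = z≤n
read-≤ (x≤B ∷ _)   zero    = x≤B
read-≤ (_ ∷ m≤B)   (suc a) = read-≤ m≤B a

length-write-≤ : ∀ {A} m a y → length m ≤ A → a < A → length (write m a y) ≤ A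
length-write-≤ []      zero    y m≤A       a<A       = a<A
length-write-≤ []      (suc a) y m≤A       (s≤s a<A) = s≤s (length-write-≤ [] a y z≤n a<A)
length-write-≤ (_ ∷ m) zero    y m≤A       a<A       = m≤A
length-write-≤ (_ ∷ m) (suc a) y (s≤s m≤A) (s≤s a<A) = s≤s (length-write-≤ m a y m≤A a<A)

totalLen-≤ : ∀ {B m} → All (_≤ B) m → totalLen m ≤ length m * len B
totalLen-≤ []          = z≤n
totalLen-≤ (x≤B ∷ m≤B) = +-mono-≤ (len-mono _ x≤B) (totalLen-≤ m≤B)

-- The machine also charges for the length of constants and register numbers in the program text.
-- Keeping them at most 32, hence at most B, bounds this charge by `len B`.
literal : Operand → ℕ
literal (const k) = k
literal (reg r)   = r
literal (ind r)   = r
literal (input r) = r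

destLiteral : Dest → ℕ
destLiteral (reg r) = r
destLiteral (ind r) = r

-- Runs inside a box: the memory has at most A cells, each of value at most B,
-- so that every elementary step costs at most one unit.
module Boxed (inp : List ℕ) (A B : ℕ) (18≤A : 18 ≤ A) (32≤B : 32 ≤ B) (inp≤B : ∀ i → read inp i ≤ B) where

  open Semantics inp using (value; operandCost; address; destCost; update)

  -- 8 = 2 + 3 + 3: a destination costs at most 2 lengths and each of the two operands at most 3.
  -- One unit thus also pays for the test of a branch or loop.
  unit space : ℕ
  unit  = 8 * len B
  space = A * len B

  Fits : Memory → Set
  Fits m = All (_≤ B) m × length m ≤ A

  -- Fitting into the box is assumed inside the record. Sequencing hands it on from one step to the
  -- next, so intermediate memories never have to be shown to fit separately.
  record Exec (P : Program) (m m′ : Memory) (k : ℕ) : Set where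
    constructor exec
    field
      run : Fits m → ∃[ t ] ∃[ s ] (Run inp P m m′ t s × t ≤ k * unit × s ≤ space × Fits m′)

  small : ∀ k → T (k ≤ᵇ 32) → k ≤ B
  small k k≤32 = ≤-trans (≤ᵇ⇒≤ k 32 k≤32) 32≤B

  private
    3L : ∀ a b c → a ≤ len B → b ≤ len B → c ≤ len B → a + b + c ≤ 3 * len B
    3L a b c p q r = ≤-trans (+-mono-≤ (+-mono-≤ p q) r) (≤-reflexive (lem (len B)))
      where
      lem : ∀ x → x + x + x ≡ 3 * x
      lem = solve-∀

  operandCost-≤ : ∀ {m} → All (_≤ B) m → ∀ x → T (literal x ≤ᵇ 32) → operandCost m x ≤ 3 * len B
  operandCost-≤ m≤B (const k) ok = ≤-trans (len-mono k (small k ok)) (m≤m+n _ _)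
  operandCost-≤ m≤B (reg r)   ok =
    ≤-trans (m≤m+n _ 0) (3L _ _ 0 (len-mono r (small r ok)) (len-mono _ (read-≤ m≤B r)) z≤n)
  operandCost-≤ m≤B (ind r)   ok =
    3L _ _ _ (len-mono r (small r ok)) (len-mono _ (read-≤ m≤B r)) (len-mono _ (read-≤ m≤B _))
  operandCost-≤ m≤B (input r) ok =
    3L _ _ _ (len-mono r (small r ok)) (len-mono _ (read-≤ m≤B r)) (len-mono _ (inp≤B _))

  destCost-≤ : ∀ {m} → All (_≤ B) m → ∀ d → T (destLiteral d ≤ᵇ 32) → destCost m d ≤ 2 * len B
  destCost-≤ m≤B (reg r) ok = ≤-trans (len-mono r (small r ok)) (m≤m+n _ _)
  destCost-≤ m≤B (ind r) ok =
    +-mono-≤ (len-mono r (small r ok)) (≤-trans (len-mono _ (read-≤ m≤B r)) (m≤m+n _ 0))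

  totalLen-space : ∀ {m} → Fits m → totalLen m ≤ space
  totalLen-space (m≤B , m≤A) = ≤-trans (totalLen-≤ m≤B) (*-monoˡ-≤ (len B) m≤A)

  3L≤unit : 3 * len B ≤ unit
  3L≤unit = *-monoˡ-≤ (len B) (≤ᵇ⇒≤ 3 8 _)

  assign : ∀ {m} d x o y
    {_ : T (destLiteral d ≤ᵇ 32)} {_ : T (literal x ≤ᵇ 32)} {_ : T (literal y ≤ᵇ 32)} →
    apply o (value m x) (value m y) ≤ B → address m d < A →
    Exec (d ≔ x ⟨ o ⟩ y) m (update m d x o y) 1
  assign {m} d x o y {okd} {okx} {oky} v≤B a<A = exec λ fits@(m≤B , m≤A) →
    let fits′ = All-write (address m d) m≤B v≤B , length-write-≤ m (address m d) _ m≤A a<A in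
    _ , _ , Semantics.assign , time m≤B , ⊔-lub (totalLen-space fits) (totalLen-space fits′) , fits′
    where
    lem : ∀ x → 2 * x + 3 * x + 3 * x ≡ 1 * (8 * x)
    lem = solve-∀
    time : All (_≤ B) m → destCost m d + operandCost m x + operandCost m y ≤ 1 * unit
    time m≤B = ≤-trans
      (+-mono-≤ (+-mono-≤ (destCost-≤ m≤B d okd) (operandCost-≤ m≤B x okx)) (operandCost-≤ m≤B y oky))
      (≤-reflexive (lem (len B)))

  set : ∀ {m} r x o y
    {_ : T (r <ᵇ 18)} {_ : T (r ≤ᵇ 32)} {_ : T (literal x ≤ᵇ 32)} {_ : T (literal y ≤ᵇ 32)} →
    apply o (value m x) (value m y) ≤ B →
    Exec (reg r ≔ x ⟨ o ⟩ y) m (update m (reg r) x o y) 1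
  set r x o y {r<18} {okr} {okx} {oky} v≤B =
    assign (reg r) x o y {okr} {okx} {oky} v≤B (≤-trans (<ᵇ⇒< r 18 r<18) 18≤A)

  clear : ∀ {m} r {_ : T (r <ᵇ 18)} {_ : T (r ≤ᵇ 32)} →
    Exec (reg r ≔ const 0 ⟨ add ⟩ const 0) m (write m r 0) 1
  clear r {r<18} {okr} = set r (const 0) add (const 0) {r<18} {okr} z≤n

  infixr 5 _▹_
  _▹_ : ∀ {P Q m₁ m₂ m₃ k₁ k₂} → Exec P m₁ m₂ k₁ → Exec Q m₂ m₃ k₂ → Exec (P ⨾ Q) m₁ m₃ (k₁ + k₂)
  _▹_ {k₁ = k₁} {k₂} (exec p) (exec q) = exec λ fits →
    let _ , _ , run₁ , t₁≤ , s₁≤ , fits₁ = p fits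
        _ , _ , run₂ , t₂≤ , s₂≤ , fits₂ = q fits₁
    in _ , _ , Semantics.seq run₁ run₂ ,
       ≤-trans (+-mono-≤ t₁≤ t₂≤) (≤-reflexive (sym (*-distribʳ-+ unit k₁ k₂))) ,
       ⊔-lub s₁≤ s₂≤ , fits₂

  weaken : ∀ {P m m′ k k′} → k ≤ k′ → Exec P m m′ k → Exec P m m′ k′
  weaken k≤k′ (exec p) = exec λ fits →
    let _ , _ , run , t≤ , s≤ , fits′ = p fits
    in _ , _ , run , ≤-trans t≤ (*-monoˡ-≤ unit k≤k′) , s≤ , fits′

  pass : ∀ {m} → Exec skip m m 1
  pass = exec λ fits → _ , _ , Semantics.skip , s≤s z≤n , totalLen-space fits , fits

  branch-nonzero : ∀ {x P Q m m′ k} {ok : T (literal x ≤ᵇ 32)} → value m x ≢ 0 →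
    Exec P m m′ k → Exec (ifnz x then P else Q) m m′ (suc k)
  branch-nonzero {x} {ok = ok} x≢0 (exec p) = exec λ fits@(m≤B , _) →
    let _ , _ , run , t≤ , s≤ , fits′ = p fits
    in _ , _ , Semantics.if-nonzero x≢0 run ,
       +-mono-≤ (≤-trans (operandCost-≤ m≤B x ok) 3L≤unit) t≤ , s≤ , fits′

  branch-zero : ∀ {x P Q m m′ k} {ok : T (literal x ≤ᵇ 32)} → value m x ≡ 0 →
    Exec Q m m′ k → Exec (ifnz x then P else Q) m m′ (suc k)
  branch-zero {x} {ok = ok} x≡0 (exec p) = exec λ fits@(m≤B , _) →
    let _ , _ , run , t≤ , s≤ , fits′ = p fits
    in _ , _ , Semantics.if-zero x≡0 run ,
       +-mono-≤ (≤-trans (operandCost-≤ m≤B x ok) 3L≤unit) t≤ , s≤ , fits′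

  loop-done : ∀ {x P m} {ok : T (literal x ≤ᵇ 32)} → value m x ≡ 0 →
    Exec (whilenz x loop P) m m 1
  loop-done {x} {ok = ok} x≡0 = exec λ fits@(m≤B , _) →
    _ , _ , Semantics.while-zero x≡0 ,
    ≤-trans (≤-trans (operandCost-≤ m≤B x ok) 3L≤unit) (m≤m+n _ 0) , totalLen-space fits , fits

  loop-step : ∀ {x P m₁ m₂ m₃ k₁ k₂} {ok : T (literal x ≤ᵇ 32)} → value m₁ x ≢ 0 →
    Exec P m₁ m₂ k₁ → Exec (whilenz x loop P) m₂ m₃ k₂ →
    Exec (whilenz x loop P) m₁ m₃ (suc k₁ + k₂)
  loop-step {x} {k₁ = k₁} {k₂} {ok} x≢0 (exec p) (exec q) = exec λ fits@(m≤B , _) →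
    let _ , _ , run₁ , t₁≤ , s₁≤ , fits₁ = p fits
        _ , _ , run₂ , t₂≤ , s₂≤ , fits₂ = q fits₁
    in _ , _ , Semantics.while-nonzero x≢0 run₁ run₂ ,
       ≤-trans (+-mono-≤ (+-mono-≤ (≤-trans (operandCost-≤ m≤B x ok) 3L≤unit) t₁≤) t₂≤)
               (≤-reflexive (sym (*-distribʳ-+ unit (suc k₁) k₂))) ,
       ⊔-lub s₁≤ s₂≤ , fits₂

-- Finite sums

module _ {A : Set} where

  Σ : List A → (A → ℕ) → ℕ
  Σ []       f = 0
  Σ (x ∷ xs) f = f x + Σ xs f

  Σ-cong : ∀ xs {f g : A → ℕ} → (∀ x → f x ≡ g x) → Σ xs f ≡ Σ xs g
  Σ-cong []       f≡g = refl
  Σ-cong (x ∷ xs) f≡g = cong₂ _+_ (f≡g x) (Σ-cong xs f≡g)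

  Σ-congᴬ : ∀ {P : A → Set} {xs f g} → All P xs → (∀ x → P x → f x ≡ g x) → Σ xs f ≡ Σ xs g
  Σ-congᴬ []         f≡g = refl
  Σ-congᴬ (px ∷ pxs) f≡g = cong₂ _+_ (f≡g _ px) (Σ-congᴬ pxs f≡g)

  Σ-mono : ∀ xs {f g : A → ℕ} → (∀ x → f x ≤ g x) → Σ xs f ≤ Σ xs g
  Σ-mono []       f≤g = z≤n
  Σ-mono (x ∷ xs) f≤g = +-mono-≤ (f≤g x) (Σ-mono xs f≤g)

  Σ-++ : ∀ xs ys (f : A → ℕ) → Σ (xs ++ ys) f ≡ Σ xs f + Σ ys f
  Σ-++ []       ys f = refl
  Σ-++ (x ∷ xs) ys f = trans (cong (f x +_) (Σ-++ xs ys f)) (sym (+-assoc (f x) _ _))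

  Σ-*ˡ : ∀ xs k (f : A → ℕ) → Σ xs (λ x → k * f x) ≡ k * Σ xs f
  Σ-*ˡ []       k f = sym (*-zeroʳ k)
  Σ-*ˡ (x ∷ xs) k f = trans (cong (k * f x +_) (Σ-*ˡ xs k f)) (sym (*-distribˡ-+ k (f x) _))

  Σ-*ʳ : ∀ xs k (f : A → ℕ) → Σ xs (λ x → f x * k) ≡ Σ xs f * k
  Σ-*ʳ []       k f = refl
  Σ-*ʳ (x ∷ xs) k f = trans (cong (f x * k +_) (Σ-*ʳ xs k f)) (sym (*-distribʳ-+ k (f x) _))

  Σ-+ : ∀ xs (f g : A → ℕ) → Σ xs (λ x → f x + g x) ≡ Σ xs f + Σ xs g
  Σ-+ []       f g = refl
  Σ-+ (x ∷ xs) f g = trans (cong (f x + g x +_) (Σ-+ xs f g)) (lem (f x) (g x) _ _)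
    where
    lem : ∀ a b c d → a + b + (c + d) ≡ a + c + (b + d)
    lem = solve-∀

  Σ-zero : ∀ xs → Σ xs (λ _ → 0) ≡ 0
  Σ-zero []       = refl
  Σ-zero (x ∷ xs) = Σ-zero xs

  Σ-positive : ∀ xs (f : A → ℕ) → Σ xs f ≢ 0 → ∃[ x ] (x ∈ˡ xs × f x ≢ 0)
  Σ-positive []       f Σ≢0 = ⊥-elim (Σ≢0 refl)
  Σ-positive (x ∷ xs) f Σ≢0 with f x ≟ 0
  ... | no fx≢0 = x , here refl , fx≢0
  ... | yes fx≡0 with Σ-positive xs f (λ Σ≡0 → Σ≢0 (cong₂ _+_ fx≡0 Σ≡0))
  ...   | y , y∈xs , fy≢0 = y , there y∈xs , fy≢0

  term≤Σ : ∀ {xs x} (f : A → ℕ) → x ∈ˡ xs → f x ≤ Σ xs f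
  term≤Σ f (here refl)  = m≤m+n _ _
  term≤Σ f (there x∈xs) = ≤-trans (term≤Σ f x∈xs) (m≤n+m _ _)

Σ-swap : ∀ {A B : Set} (xs : List A) (ys : List B) (f : A → B → ℕ) →
  Σ xs (λ x → Σ ys (f x)) ≡ Σ ys (λ y → Σ xs (λ x → f x y))
Σ-swap []       ys f = sym (Σ-zero ys)
Σ-swap (x ∷ xs) ys f =
  trans (cong (Σ ys (f x) +_) (Σ-swap xs ys f)) (sym (Σ-+ ys (f x) (λ y → Σ xs (λ x → f x y))))

-- Summation runs downwards because the loops of the program count down to 0; both then unfold in
-- the same order.
Σ-< : ℕ → (ℕ → ℕ) → ℕ
Σ-< n = Σ (downFrom n)

-- Pairing 2y with 2y + 1 splits off the lowest binary digit, which is the induction step of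
-- `inclusion-exclusion`.
Σ-<-double : ∀ m f → Σ-< (m + m) f ≡ Σ-< m (λ y → f (y + y) + f (suc (y + y)))
Σ-<-double zero    f = refl
Σ-<-double (suc m) f rewrite +-suc m m =
  trans (cong (λ z → f (suc (m + m)) + (f (m + m) + z)) (Σ-<-double m f))
        (lem (f (suc (m + m))) (f (m + m)) _)
  where
  lem : ∀ a b c → a + (b + c) ≡ b + a + c
  lem = solve-∀

Σ-<-cong : ∀ n {f g} → (∀ x → x < n → f x ≡ g x) → Σ-< n f ≡ Σ-< n g
Σ-<-cong zero    f≡g = refl
Σ-<-cong (suc n) f≡g = cong₂ _+_ (f≡g n ≤-refl) (Σ-<-cong n (λ x x<n → f≡g x (m<n⇒m<1+n x<n)))

downFrom-∈ : ∀ {v n} → v < n → v ∈ˡ downFrom n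
downFrom-∈ {v} {suc n} v<1+n with v ≟ n
... | yes refl = here refl
... | no v≢n   = there (downFrom-∈ (≤∧≢⇒< (≤-pred v<1+n) v≢n))

∈-downFrom : ∀ {v n} → v ∈ˡ downFrom n → v < n
∈-downFrom {n = suc n} (here refl) = ≤-refl
∈-downFrom {n = suc n} (there v∈)  = m<n⇒m<1+n (∈-downFrom v∈)

Σ-cartesianProductWith : ∀ {A B C : Set} (h : A → B → C) xs ys (f : C → ℕ) →
  Σ (cartesianProductWith h xs ys) f ≡ Σ xs (λ x → Σ ys (λ y → f (h x y)))
Σ-cartesianProductWith h []       ys f = refl
Σ-cartesianProductWith h (x ∷ xs) ys f =
  trans (Σ-++ (map (h x) ys) _ f) (cong₂ _+_ (Σ-map ys) (Σ-cartesianProductWith h xs ys f))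
  where
  Σ-map : ∀ ys → Σ (map (h x) ys) f ≡ Σ ys (λ y → f (h x y))
  Σ-map []       = refl
  Σ-map (y ∷ ys) = cong (f (h x y) +_) (Σ-map ys)

-- Branching walks

-- A branching walk: node t₁ t₂ attaches the walk t₂ below the root of t₁.
data Walk (V : Set) : Set where
  leaf : V → Walk V
  node : Walk V → Walk V → Walk V

module _ {V : Set} where

  root : Walk V → V
  root (leaf v)     = v
  root (node t₁ t₂) = root t₁

  size : Walk V → ℕ
  size (leaf v)     = 1
  size (node t₁ t₂) = size t₁ + size t₂

  -- This is the nesting depth of `node`, which governs how many rounds of the recursion generate
  -- the walk. It is not the depth of the tree: a root with k children already has height above k.
  height : Walk V → ℕ
  height (leaf v)     = 1
  height (node t₁ t₂) = suc (height t₁ ⊔ height t₂)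

  AllVertices : (V → Set) → Walk V → Set
  AllVertices P (leaf v)     = P v
  AllVertices P (node t₁ t₂) = AllVertices P t₁ × AllVertices P t₂

  AllEdges : (V → V → Set) → Walk V → Set
  AllEdges R (leaf v)     = ⊤
  AllEdges R (node t₁ t₂) = R (root t₁) (root t₂) × AllEdges R t₁ × AllEdges R t₂

  AnyVertex : (V → Set) → Walk V → Set
  AnyVertex P (leaf v)     = P v
  AnyVertex P (node t₁ t₂) = AnyVertex P t₁ ⊎ AnyVertex P t₂

  -- A vertex carrying children is counted again at each child, as in the recursion
  -- for W; this is harmless for 0/1-valued a.
  weight : (V → ℕ) → Walk V → ℕ
  weight a (leaf v)     = a v
  weight a (node t₁ t₂) = a (root t₁) * (weight a t₁ * weight a t₂)

  edgeWeight : (V → V → ℕ) → Walk V → ℕ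
  edgeWeight e (leaf v)     = 1
  edgeWeight e (node t₁ t₂) = e (root t₁) (root t₂) * (edgeWeight e t₁ * edgeWeight e t₂)

  1≤size : ∀ t → 1 ≤ size t
  1≤size (leaf v)     = ≤-refl
  1≤size (node t₁ t₂) = ≤-trans (1≤size t₁) (m≤m+n _ _)

  -- Each level of nesting is paid for by the part of the node that is not the deeper one, whose
  -- size is at least 1.
  height≤size : ∀ t → height t ≤ size t
  height≤size (leaf v)     = ≤-refl
  height≤size (node t₁ t₂) = ⊔-lub {size t₁ + size t₂} {suc (height t₁)}
    (≤-trans (+-mono-≤ (1≤size t₂) (height≤size t₁)) (≤-reflexive (+-comm (size t₂) (size t₁))))
    (+-mono-≤ (1≤size t₁) (height≤size t₂))

  root-all : ∀ {P} t → AllVertices P t → P (root t)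
  root-all (leaf v)     p       = p
  root-all (node t₁ t₂) (p , _) = root-all t₁ p

  weight-const : ∀ t → weight (λ _ → 1) t ≡ 1
  weight-const (leaf v)     = refl
  weight-const (node t₁ t₂) rewrite weight-const t₁ | weight-const t₂ = refl

  weight-cong : ∀ {f g} t → (∀ v → f v ≡ g v) → weight f t ≡ weight g t
  weight-cong (leaf v)     f≡g = f≡g v
  weight-cong (node t₁ t₂) f≡g = cong₂ _*_ (f≡g (root t₁)) (cong₂ _*_ (weight-cong t₁ f≡g) (weight-cong t₂ f≡g))

  weight-* : ∀ f g t → weight (λ v → f v * g v) t ≡ weight f t * weight g t
  weight-* f g (leaf v)     = refl
  weight-* f g (node t₁ t₂) =
    trans (cong (f (root t₁) * g (root t₁) *_) (cong₂ _*_ (weight-* f g t₁) (weight-* f g t₂)))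
      (lem (f (root t₁)) (g (root t₁)) (weight f t₁) (weight g t₁) _ _)
    where
    lem : ∀ x y a b c d → x * y * (a * b * (c * d)) ≡ x * (a * c) * (y * (b * d))
    lem = solve-∀

  weight-≤1 : ∀ {f} t → (∀ v → f v ≤ 1) → weight f t ≤ 1
  weight-≤1 (leaf v)     f≤1 = f≤1 v
  weight-≤1 (node t₁ t₂) f≤1 = *-mono-≤ (f≤1 (root t₁)) (*-mono-≤ (weight-≤1 t₁ f≤1) (weight-≤1 t₂ f≤1))

  edgeWeight-≤1 : ∀ {e} t → (∀ u v → e u v ≤ 1) → edgeWeight e t ≤ 1
  edgeWeight-≤1 (leaf v)     e≤1 = ≤-refl
  edgeWeight-≤1 (node t₁ t₂) e≤1 = *-mono-≤ (e≤1 _ _) (*-mono-≤ (edgeWeight-≤1 t₁ e≤1) (edgeWeight-≤1 t₂ e≤1))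

mapWalk : ∀ {A B : Set} → (A → B) → Walk A → Walk B
mapWalk f (leaf v)     = leaf (f v)
mapWalk f (node t₁ t₂) = node (mapWalk f t₁) (mapWalk f t₂)

root-map : ∀ {A B : Set} {f : A → B} t → root (mapWalk f t) ≡ f (root t)
root-map (leaf v)     = refl
root-map (node t₁ t₂) = root-map t₁

size-map : ∀ {A B : Set} {f : A → B} t → size (mapWalk f t) ≡ size t
size-map (leaf v)     = refl
size-map (node t₁ t₂) = cong₂ _+_ (size-map t₁) (size-map t₂)

mapped-< : ∀ {n} (t : Walk (Fin n)) → AllVertices (_< n) (mapWalk toℕ t)
mapped-< (leaf v)     = toℕ<n v
mapped-< (node t₁ t₂) = mapped-< t₁ , mapped-< t₂

restrict : ∀ {n} t → AllVertices (_< n) t → ∃[ t₀ ] (mapWalk (toℕ {n}) t₀ ≡ t)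
restrict (leaf v)     v<n = leaf (fromℕ< v<n) , cong leaf (toℕ-fromℕ< v<n)
restrict (node t₁ t₂) (h₁ , h₂) with restrict t₁ h₁ | restrict t₂ h₂
... | u₁ , eq₁ | u₂ , eq₂ = node u₁ u₂ , cong₂ node eq₁ eq₂

-- Vertices are natural numbers here because table cells are addressed by numbers; `restrict` leads
-- back to `Fin n`.
Family : Set
Family = ℕ → List (Walk ℕ)

-- The lists of walks generated by the recursion

module Families (n : ℕ) where

  grafts : Family → ℕ → ℕ → List (Walk ℕ)
  grafts L v zero    = []
  grafts L v (suc u) = cartesianProductWith node (L v) (L u) ++ grafts L v u

  -- The symbolic counterpart of one table update: `leaf v` stands for the summand M of the
  -- recursion and the grafts for W(v) Σ W(u). All u below n are taken as neighbours; wrong ones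
  -- later receive weight 0.
  extend : Family → ℕ → Family
  extend L v w with w ≟ v
  ... | yes _ = leaf v ∷ grafts L v n
  ... | no _  = L w

  sweepWalks : ℕ → Family → Family
  sweepWalks zero    L = L
  sweepWalks (suc v) L = sweepWalks v (extend L v)

  roundsWalks : ℕ → Family → Family
  roundsWalks zero    L = L
  roundsWalks (suc k) L = roundsWalks k (sweepWalks n L)

  Preserved : (Family → Set) → Set
  Preserved P = ∀ L v → v < n → P L → P (extend L v)

  sweep-preserves : ∀ {P} → Preserved P → ∀ v → v ≤ n → ∀ {L} → P L → P (sweepWalks v L)
  sweep-preserves step zero    v≤n pL = pL
  sweep-preserves step (suc v) v<n pL = sweep-preserves step v (<⇒≤ v<n) (step _ v v<n pL)

  rounds-preserves : ∀ {P} → Preserved P → ∀ k {L} → P L → P (roundsWalks k L)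
  rounds-preserves step zero    pL = pL
  rounds-preserves step (suc k) pL = rounds-preserves step k (sweep-preserves step n ≤-refl pL)

  Σ-grafts : ∀ L v m f →
    Σ (grafts L v m) f ≡ Σ-< m (λ u → Σ (L v) (λ t₁ → Σ (L u) (λ t₂ → f (node t₁ t₂))))
  Σ-grafts L v zero    f = refl
  Σ-grafts L v (suc m) f =
    trans (Σ-++ (cartesianProductWith node (L v) (L m)) (grafts L v m) f)
      (cong₂ _+_ (Σ-cartesianProductWith node (L v) (L m) f) (Σ-grafts L v m f))

  All-grafts : ∀ {P : Walk ℕ → Set} L v m →
    (∀ u → u < m → All (λ t₁ → All (λ t₂ → P (node t₁ t₂)) (L u)) (L v)) → All P (grafts L v m)
  All-grafts L v zero    h = []
  All-grafts {P} L v (suc m) h =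
    Allₚ.++⁺ (prod (L v) (h m ≤-refl)) (All-grafts L v m (λ u u<m → h u (m<n⇒m<1+n u<m)))
    where
    prod : ∀ ts → All (λ t₁ → All (λ t₂ → P (node t₁ t₂)) (L m)) ts → All P (cartesianProductWith node ts (L m))
    prod []       []       = []
    prod (t ∷ ts) (p ∷ ps) = Allₚ.++⁺ (Allₚ.map⁺ p) (prod ts ps)

  Rooted : Family → Set
  Rooted L = ∀ v → All (λ t → root t ≡ v) (L v)

  extend-rooted : Preserved Rooted
  extend-rooted L v _ rooted w with w ≟ v
  ... | no _     = rooted w
  ... | yes refl = refl ∷ All-grafts L v n
    (λ u _ → All.map (λ r≡v → All.tabulate (λ _ → r≡v)) (rooted v))

  Bounded : Family → Set
  Bounded L = ∀ v → v < n → All (AllVertices (_< n)) (L v)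

  extend-bounded : Preserved Bounded
  extend-bounded L v v<n bounded w w<n with w ≟ v
  ... | no _     = bounded w w<n
  ... | yes refl = v<n ∷ All-grafts L v n
    (λ u u<n → All.map
      (λ p₁ → All.map (λ p₂ → p₁ , p₂) (bounded u u<n)) (bounded v v<n))

  -- Completeness of the lists

  Covers : Family → ℕ → ℕ → Set
  Covers L k v = ∀ t → AllVertices (_< n) t → root t ≡ v → height t ≤ k → t ∈ˡ L v

  ∈-grafts : ∀ L v {u t₁ t₂} m → u < m → t₁ ∈ˡ L v → t₂ ∈ˡ L u → node t₁ t₂ ∈ˡ grafts L v m
  ∈-grafts L v {u} (suc m) u<1+m t₁∈ t₂∈ with u ≟ m
  ... | yes refl = ∈-++⁺ˡ (∈-cartesianProductWith⁺ node t₁∈ t₂∈)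
  ... | no u≢m   = ∈-++⁺ʳ (cartesianProductWith node (L v) (L m))
    (∈-grafts L v m (≤∧≢⇒< (≤-pred u<1+m) u≢m) t₁∈ t₂∈)

  grafts-cover : ∀ {L k} → (∀ w → w < n → Covers L k w) →
    ∀ v t → AllVertices (_< n) t → root t ≡ v → height t ≤ suc k → t ∈ˡ leaf v ∷ grafts L v n
  grafts-cover cov v (leaf _)     valid refl h≤ = here refl
  grafts-cover {L} cov v (node t₁ t₂) (valid₁ , valid₂) root≡v (s≤s h≤) =
    there (∈-grafts L v n (root-all t₂ valid₂)
      (cov v (subst (_< n) root≡v (root-all t₁ valid₁)) t₁ valid₁ root≡v (≤-trans (m≤m⊔n (height t₁) (height t₂)) h≤))
      (cov (root t₂) (root-all t₂ valid₂) t₂ valid₂ refl (≤-trans (m≤n⊔m (height t₁) (height t₂)) h≤)))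

  extend-covers : ∀ {L k v} w → (∀ w → w < n → Covers L k w) →
    w ≡ v ⊎ Covers L (suc k) w → Covers (extend L v) (suc k) w
  extend-covers {L} {k} {v} w cov done t valid root≡w h≤ with w ≟ v | done
  ... | yes refl | _         = grafts-cover cov v t valid root≡w h≤
  ... | no w≢v   | inj₁ w≡v  = ⊥-elim (w≢v w≡v)
  ... | no _     | inj₂ covw = covw t valid root≡w h≤

  -- An update recomputes a list instead of enlarging it, so it has to be checked that nothing
  -- already covered is lost. The walks of height at most k are generated anew, being among those of
  -- height at most k + 1.
  extend-covers-weak : ∀ {L k v} → (∀ w → w < n → Covers L k w) → ∀ w → w < n → Covers (extend L v) k w
  extend-covers-weak {L} {k} {v} cov w w<n t valid root≡w h≤ with w ≟ v
  ... | yes refl = grafts-cover cov v t valid root≡w (m≤n⇒m≤1+n h≤)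
  ... | no _     = cov w w<n t valid root≡w h≤

  -- In the middle of a sweep the vertices from v on have gained a level and all others still have
  -- the old one. Reading lists that are already updated does no harm, since they cover at least
  -- height k.
  sweep-covers : ∀ {k} v {L} → (∀ w → w < n → Covers L k w) →
    (∀ w → w < n → v ≤ w → Covers L (suc k) w) → ∀ w → w < n → Covers (sweepWalks v L) (suc k) w
  sweep-covers zero    cov done w w<n = done w w<n z≤n
  sweep-covers (suc v) cov done =
    sweep-covers v (extend-covers-weak cov) λ w w<n v≤w → extend-covers w cov (split w w<n v≤w)
    where
    split : ∀ w → w < n → v ≤ w → w ≡ v ⊎ _
    split w w<n v≤w with w ≟ v
    ... | yes w≡v = inj₁ w≡v
    ... | no w≢v  = inj₂ (done w w<n (≤∧≢⇒< v≤w (λ v≡w → w≢v (sym v≡w))))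

  rounds-cover : ∀ k {j L} → (∀ w → w < n → Covers L j w) → ∀ w → w < n → Covers (roundsWalks k L) (k + j) w
  rounds-cover zero    cov = cov
  rounds-cover (suc k) {j} {L} cov w w<n =
    subst (λ i → Covers (roundsWalks k (sweepWalks n L)) i w) (+-suc k j)
      (rounds-cover k (sweep-covers n cov (λ w w<n n≤w → ⊥-elim (<⇒≱ w<n n≤w))) w w<n)

  walks : ℕ → Family
  walks k = roundsWalks k (λ _ → [])

  walks-cover : ∀ k v t → AllVertices (_< n) t → root t ≡ v → size t ≤ k → t ∈ˡ walks k v
  walks-cover k v t valid refl size≤k =
    rounds-cover k {0} (λ w _ t _ _ h≤0 → ⊥-elim (height≢0 t h≤0)) v (root-all t valid) t valid refl
      (≤-trans (height≤size t) (≤-trans size≤k (m≤m+n k 0)))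
    where
    height≢0 : ∀ t → height t ≤ 0 → _
    height≢0 (leaf v)     ()
    height≢0 (node t₁ t₂) ()

  walks-bounded : ∀ k → Bounded (walks k)
  walks-bounded k = rounds-preserves extend-bounded k (λ _ _ → [])

  -- 4n is the least D for which x = 1 / D + n x² has a real solution. Its double root x = 1 / 2n is
  -- the bound that `Kraft` keeps invariant.
  D : ℕ
  D = (n + n) + (n + n)

  -- D ^ (q - s), or 0 when s exceeds q.
  kraft : ℕ → ℕ → ℕ
  kraft q       zero    = D ^ q
  kraft zero    (suc s) = 0
  kraft (suc q) (suc s) = kraft q s

  -- This is Σ D ^ (- size) ≤ 1 / 2n with the denominators 2n and D ^ q cleared. Dropping the sizes
  -- above q keeps every term a natural number.
  Kraft : Family → Set
  Kraft L = ∀ v q → (n + n) * Σ (L v) (λ t → kraft q (size t)) ≤ D ^ q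

  -- Once a first part of size s is fixed, the second part is measured against the budget q - s. If
  -- s exceeds q, every term vanishes.
  kraft-shift : ∀ (ts : List (Walk ℕ)) → (∀ q → (n + n) * Σ ts (λ t → kraft q (size t)) ≤ D ^ q) →
    ∀ q s → (n + n) * Σ ts (λ t → kraft q (s + size t)) ≤ kraft q s
  kraft-shift ts h q       zero    = h q
  kraft-shift ts h zero    (suc s) =
    ≤-reflexive (trans (cong ((n + n) *_) (Σ-zero ts)) (*-zeroʳ (n + n)))
  kraft-shift ts h (suc q) (suc s) = kraft-shift ts h q s

  Σ-<-const : ∀ m {f b} → (∀ u → f u ≤ b) → Σ-< m f ≤ m * b
  Σ-<-const zero    f≤b = z≤n
  Σ-<-const (suc m) f≤b = +-mono-≤ (f≤b m) (Σ-<-const m f≤b)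

  -- The weights D ^ (- size) sum to at most 1 / 2n over the walks from any
  -- vertex, since 1 / 4n + n · (1 / 2n) ² = 1 / 2n.
  extend-kraft : 1 ≤ n → Preserved Kraft
  extend-kraft 1≤n L v v<n kr w q with w ≟ v
  ... | no _     = kr w q
  ... | yes refl = *-cancelˡ-≤ 2 (begin
    2 * ((n + n) * (kraft q 1 + G))  ≡⟨ lem₁ n (kraft q 1) G ⟩
    D * kraft q 1 + D * G            ≤⟨ +-mono-≤ (leaf≤ q) grafts≤ ⟩
    D ^ q + D ^ q                    ≡⟨ cong (D ^ q +_) (sym (+-identityʳ _)) ⟩
    2 * D ^ q                        ∎)
    where
    open ≤-Reasoning
    G : ℕ
    G = Σ (grafts L v n) (λ t → kraft q (size t))
    lem₁ : ∀ n a b → 2 * ((n + n) * (a + b)) ≡ ((n + n) + (n + n)) * a + ((n + n) + (n + n)) * b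
    lem₁ = solve-∀
    lem₂ : ∀ n g → n * (((n + n) + (n + n)) * g) ≡ (n + n) * ((n + n) * g)
    lem₂ = solve-∀
    leaf≤ : ∀ q → D * kraft q 1 ≤ D ^ q
    leaf≤ zero    = ≤-trans (≤-reflexive (*-zeroʳ D)) z≤n
    leaf≤ (suc q) = ≤-refl
    neighbour≤ : ∀ u → (n + n) * ((n + n) * Σ (L v) (λ t₁ → Σ (L u) (λ t₂ → kraft q (size t₁ + size t₂)))) ≤ D ^ q
    neighbour≤ u = begin
      (n + n) * ((n + n) * Σ (L v) (λ t₁ → Σ (L u) (λ t₂ → kraft q (size t₁ + size t₂))))
        ≡⟨ cong ((n + n) *_) (sym (Σ-*ˡ (L v) (n + n) _)) ⟩
      (n + n) * Σ (L v) (λ t₁ → (n + n) * Σ (L u) (λ t₂ → kraft q (size t₁ + size t₂)))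
        ≤⟨ *-monoʳ-≤ (n + n) (Σ-mono (L v) (λ t₁ → kraft-shift (L u) (kr u) q (size t₁))) ⟩
      (n + n) * Σ (L v) (λ t₁ → kraft q (size t₁))
        ≤⟨ kr v q ⟩
      D ^ q ∎
    grafts≤ : D * G ≤ D ^ q
    grafts≤ = *-cancelˡ-≤ n {{>-nonZero 1≤n}} (begin
      n * (D * G)
        ≡⟨ lem₂ n G ⟩
      (n + n) * ((n + n) * G)
        ≡⟨ cong (λ z → (n + n) * ((n + n) * z)) (Σ-grafts L v n _) ⟩
      (n + n) * ((n + n) * Σ-< n (λ u → Σ (L v) (λ t₁ → Σ (L u) (λ t₂ → kraft q (size t₁ + size t₂)))))
        ≡⟨ cong ((n + n) *_) (sym (Σ-*ˡ (downFrom n) (n + n) _)) ⟩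
      (n + n) * Σ-< n (λ u → (n + n) * Σ (L v) (λ t₁ → Σ (L u) (λ t₂ → kraft q (size t₁ + size t₂))))
        ≡⟨ sym (Σ-*ˡ (downFrom n) (n + n) _) ⟩
      Σ-< n (λ u → (n + n) * ((n + n) * Σ (L v) (λ t₁ → Σ (L u) (λ t₂ → kraft q (size t₁ + size t₂)))))
        ≤⟨ Σ-<-const n neighbour≤ ⟩
      n * D ^ q ∎)

  walks-kraft : 1 ≤ n → ∀ k → Kraft (walks k)
  walks-kraft 1≤n k = rounds-preserves (extend-kraft 1≤n) k
    (λ _ q → ≤-trans (≤-reflexive (*-zeroʳ (n + n))) z≤n)

  within : ℕ → ℕ → ℕ
  within q       zero    = 1
  within zero    (suc s) = 0
  within (suc q) (suc s) = within q s

  within-≤ : ∀ {q s} → s ≤ q → within q s ≡ 1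
  within-≤ z≤n       = refl
  within-≤ (s≤s s≤q) = within-≤ s≤q

  within-≢0 : ∀ q s → within q s ≢ 0 → s ≤ q
  within-≢0 q       zero    _ = z≤n
  within-≢0 zero    (suc s) h = ⊥-elim (h refl)
  within-≢0 (suc q) (suc s) h = s≤s (within-≢0 q s h)

  1≤D : 1 ≤ n → 1 ≤ D
  1≤D 1≤n = ≤-trans 1≤n (≤-trans (m≤m+n n n) (m≤m+n (n + n) (n + n)))

  1≤D^ : 1 ≤ n → ∀ q → 1 ≤ D ^ q
  1≤D^ 1≤n q = m^n>0 D {{>-nonZero (1≤D 1≤n)}} q

  within≤kraft : 1 ≤ n → ∀ q s → within q s ≤ kraft q s
  within≤kraft 1≤n q       zero    = 1≤D^ 1≤n q
  within≤kraft 1≤n zero    (suc s) = z≤n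
  within≤kraft 1≤n (suc q) (suc s) = within≤kraft 1≤n q s

  -- A walk of size at most q contributes at least 1 to the Kraft sum. The n roots together
  -- therefore give at most n · D ^ q / 2n = D ^ q / 2, and the lost half makes the inequality
  -- strict.
  count-walks : 1 ≤ n → ∀ k q → Σ-< n (λ v → Σ (walks k v) (λ t → within q (size t))) < D ^ q
  count-walks 1≤n k q = *-cancelˡ-< (n + n) _ _ (begin-strict
    (n + n) * Σ-< n C      ≡⟨ sym (Σ-*ˡ (downFrom n) (n + n) C) ⟩
    Σ-< n (λ v → (n + n) * C v)
      ≤⟨ Σ-<-const n (λ v → ≤-trans (*-monoʳ-≤ (n + n) (Σ-mono (walks k v) (λ t → within≤kraft 1≤n q (size t)))) (walks-kraft 1≤n k v q)) ⟩
    n * D ^ q              <⟨ m<m+n (n * D ^ q) (*-mono-≤ 1≤n (1≤D^ 1≤n q)) ⟩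
    n * D ^ q + n * D ^ q  ≡⟨ sym (*-distribʳ-+ (D ^ q) n n) ⟩
    (n + n) * D ^ q        ∎)
    where
    open ≤-Reasoning
    C : ℕ → ℕ
    C v = Σ (walks k v) (λ t → within q (size t))

-- Trees and branching walks in a graph

module _ {V : Set} {R : V → V → Set} where

  -- The new vertex is hung below one occurrence of x. Roots of all parts stay the same, so the
  -- edges above the occurrence remain valid.
  attach : ∀ {x y} t → AnyVertex (_≡ x) t → AllEdges R t → R x y →
    ∃[ t′ ] (AllEdges R t′ × root t′ ≡ root t × size t′ ≡ suc (size t)
           × AnyVertex (_≡ y) t′ × (∀ v → AnyVertex (_≡ v) t → AnyVertex (_≡ v) t′))
  attach {x} {y} (leaf x) refl edges xRy =
    node (leaf x) (leaf y) , (xRy , tt , tt) , refl , refl , inj₂ refl , (λ _ → inj₁)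
  attach (node t₁ t₂) (inj₁ x∈t₁) (r , e₁ , e₂) xRy with attach t₁ x∈t₁ e₁ xRy
  ... | t₁′ , e₁′ , root≡ , size≡ , y∈ , old =
    node t₁′ t₂ , (subst (λ z → R z (root t₂)) (sym root≡) r , e₁′ , e₂) , root≡ , cong (_+ size t₂) size≡ , inj₁ y∈ ,
    λ { v (inj₁ v∈) → inj₁ (old v v∈) ; v (inj₂ v∈) → inj₂ v∈ }
  attach (node t₁ t₂) (inj₂ x∈t₂) (r , e₁ , e₂) xRy with attach t₂ x∈t₂ e₂ xRy
  ... | t₂′ , e₂′ , root≡ , size≡ , y∈ , old =
    node t₁ t₂′ , (subst (R (root t₁)) (sym root≡) r , e₁ , e₂′) , refl ,
    trans (cong (size t₁ +_) size≡) (+-suc (size t₁) (size t₂)) , inj₂ y∈ ,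
    λ { v (inj₁ v∈) → inj₁ v∈ ; v (inj₂ v∈) → inj₂ (old v v∈) }

any-vertex : ∀ {V : Set} {P : V → Set} {v} t → AnyVertex (_≡ v) t → P v → AnyVertex P t
any-vertex (leaf v)     refl       pv = pv
any-vertex (node t₁ t₂) (inj₁ v∈) pv = inj₁ (any-vertex t₁ v∈ pv)
any-vertex (node t₁ t₂) (inj₂ v∈) pv = inj₂ (any-vertex t₂ v∈ pv)

common-vertex : ∀ {V : Set} {P Q : V → Set} t → AllVertices P t → AnyVertex Q t → ∃[ v ] (P v × Q v)
common-vertex (leaf v)     p        q        = v , p , q
common-vertex (node t₁ t₂) (p , _)  (inj₁ q) = common-vertex t₁ p q
common-vertex (node t₁ t₂) (_ , p)  (inj₂ q) = common-vertex t₂ p q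

all-map : ∀ {V : Set} {P Q : V → Set} → (∀ {v} → P v → Q v) → ∀ t → AllVertices P t → AllVertices Q t
all-map f (leaf v)     p       = f p
all-map f (node t₁ t₂) (p , q) = all-map f t₁ p , all-map f t₂ q

edges-map : ∀ {V : Set} {P Q : V → V → Set} → (∀ {u v} → P u v → Q u v) → ∀ t → AllEdges P t → AllEdges Q t
edges-map f (leaf v)     p           = p
edges-map f (node t₁ t₂) (r , p , q) = f r , edges-map f t₁ p , edges-map f t₂ q

module _ {n : ℕ} where

  crossing : ∀ {R : Fin n → Fin n → Set} (S : Subset n) {u v} → Star R u v → u ∈ S → v ∉ S →
    ∃[ x ] ∃[ y ] (x ∈ S × y ∉ S × R x y)
  crossing S ε u∈S v∉S = ⊥-elim (v∉S u∈S)
  crossing S (_◅_ {j = w} uRw path) u∈S v∉S with w ∈? S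
  ... | yes w∈S = crossing S path w∈S v∉S
  ... | no w∉S  = _ , w , u∈S , w∉S , uRw

  ∣insert∣-< : ∀ (S : Subset n) {y} → y ∉ S → ∣ S ∣ < ∣ S ∪ ⁅ y ⁆ ∣
  ∣insert∣-< S {y} y∉S = p⊂q⇒∣p∣<∣q∣ (p⊆p∪q ⁅ y ⁆ , y , x∈p∪q⁺ (inj₂ (x∈⁅x⁆ y)) , y∉S)

∣insert∣-≤ : ∀ {n} (S : Subset n) y → ∣ S ∪ ⁅ y ⁆ ∣ ≤ suc ∣ S ∣
∣insert∣-≤ (outside ∷ S) zero    = s≤s (≤-reflexive (cong ∣_∣ (∪-identityʳ S)))
∣insert∣-≤ (inside  ∷ S) zero    = s≤s (≤-trans (≤-reflexive (cong ∣_∣ (∪-identityʳ S))) (n≤1+n _))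
∣insert∣-≤ (outside ∷ S) (suc y) = ∣insert∣-≤ S y
∣insert∣-≤ (inside  ∷ S) (suc y) = s≤s (∣insert∣-≤ S y)

module _ {n : ℕ} {G : Graph n} where

  GEdge : Fin n → Fin n → Set
  GEdge u v = T (Graph.edge G u v)

  module _ (H : Subgraph G) (connected : Subgraph.Connected H) where
    open Subgraph H

    -- S is the set of vertices visited so far. While it misses a vertex of `H`, connectedness
    -- supplies an edge leaving S, and its far end is attached to the walk. The fuel k bounds the
    -- number of missing vertices, so at k = 0 a leaving edge would make S larger than `verts`.
    walk-through-from : ∀ k t (S : Subset n) → AllEdges Adj t → root t ∈ S → S ⊆ verts →
      (∀ v → v ∈ S → AnyVertex (_≡ v) t) → size t ≤ ∣ S ∣ → ∣ verts ∣ ≤ k + ∣ S ∣ →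
      ∃[ t′ ] (AllEdges Adj t′ × size t′ ≤ ∣ verts ∣ × (∀ v → v ∈ verts → AnyVertex (_≡ v) t′))
    walk-through-from k t S edges r∈S S⊆ all size≤ fuel
      with any? (λ v → (v ∈? verts) ×-dec ¬? (v ∈? S))
    ... | no none = t , edges , ≤-trans size≤ (p⊆q⇒∣p∣≤∣q∣ S⊆) , λ v v∈ → all v (inS v v∈)
      where
      inS : ∀ v → v ∈ verts → v ∈ S
      inS v v∈ with v ∈? S
      ... | yes v∈S = v∈S
      ... | no v∉S  = ⊥-elim (none (v , v∈ , v∉S))
    ... | yes (v , v∈ , v∉S) with crossing S (connected (S⊆ r∈S) v∈) r∈S v∉S
    ...   | x , y , x∈S , y∉S , xy with attach t (all x x∈S) edges xy
    ...     | t′ , edges′ , root≡ , size≡ , y∈t′ , old = continue k fuel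
      where
      S′ : Subset n
      S′ = S ∪ ⁅ y ⁆
      S′⊆ : S′ ⊆ verts
      S′⊆ z∈ with x∈p∪q⁻ S ⁅ y ⁆ z∈
      ... | inj₁ z∈S = S⊆ z∈S
      ... | inj₂ z∈y = subst (_∈ verts) (sym (x∈⁅y⁆⇒x≡y y z∈y)) (proj₂ (endpoints xy))
      all′ : ∀ z → z ∈ S′ → AnyVertex (_≡ z) t′
      all′ z z∈ with x∈p∪q⁻ S ⁅ y ⁆ z∈
      ... | inj₁ z∈S = old z (all z z∈S)
      ... | inj₂ z∈y = subst (λ z → AnyVertex (_≡ z) t′) (sym (x∈⁅y⁆⇒x≡y y z∈y)) y∈t′
      continue : ∀ k → ∣ verts ∣ ≤ k + ∣ S ∣ → _
      continue zero    fuel = ⊥-elim (<⇒≱ (∣insert∣-< S y∉S) (≤-trans (p⊆q⇒∣p∣≤∣q∣ S′⊆) fuel))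
      continue (suc k) fuel = walk-through-from k t′ S′ edges′
        (subst (_∈ S′) (sym root≡) (x∈p∪q⁺ (inj₁ r∈S))) S′⊆ all′
        (≤-trans (≤-reflexive size≡) (≤-trans (s≤s size≤) (∣insert∣-< S y∉S)))
        (≤-trans fuel (≤-trans (≤-reflexive (sym (+-suc k ∣ S ∣))) (+-monoʳ-≤ k (∣insert∣-< S y∉S))))

    walk-through : Nonempty verts →
      ∃[ t ] (AllEdges Adj t × size t ≤ ∣ verts ∣ × (∀ v → v ∈ verts → AnyVertex (_≡ v) t))
    walk-through (r , r∈) = walk-through-from ∣ verts ∣ (leaf r) ⁅ r ⁆ tt (x∈⁅x⁆ r)
      (λ z∈ → subst (_∈ verts) (sym (x∈⁅y⁆⇒x≡y r z∈)) r∈)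
      (λ v v∈ → sym (x∈⁅y⁆⇒x≡y r v∈)) (≤-reflexive (sym (∣⁅x⁆∣≡1 r)))
      (≤-trans (≤-reflexive (sym (+-identityʳ _))) (+-monoʳ-≤ ∣ verts ∣ z≤n))

  singleton : Fin n → Subgraph G
  singleton r = record
    { verts = ⁅ r ⁆ ; edge = λ _ _ → false ; symm = λ () ; edge⊆ = λ () ; endpoints = λ () }

  singleton-tree : ∀ r → Subgraph.IsTree (singleton r)
  singleton-tree r = (r , x∈⁅x⁆ r) , connected , acyclic
    where
    connected : Subgraph.Connected (singleton r)
    connected u∈ v∈ rewrite x∈⁅y⁆⇒x≡y r u∈ | x∈⁅y⁆⇒x≡y r v∈ = ε
    acyclic : Subgraph.Acyclic (singleton r)
    acyclic u []      (() , _)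
    acyclic u (_ ∷ _) (_ , _ , () ∷ _)

  module AddLeaf (H : Subgraph G) (tree : Subgraph.IsTree H) {x w : Fin n}
    (x∈ : x ∈ Subgraph.verts H) (w∉ : w ∉ Subgraph.verts H) (xw : GEdge x w) where
    open Subgraph H

    NewEdge : Fin n → Fin n → Set
    NewEdge a b = T (edge a b) ⊎ (a ≡ x × b ≡ w) ⊎ (a ≡ w × b ≡ x)

    newEdge? : ∀ a b → Dec (NewEdge a b)
    newEdge? a b = T? (edge a b) ⊎-dec ((a ≟ᶠ x) ×-dec (b ≟ᶠ w)) ⊎-dec ((a ≟ᶠ w) ×-dec (b ≟ᶠ x))

    flip-edge : ∀ {a b} → NewEdge a b → NewEdge b a
    flip-edge (inj₁ e)               = inj₁ (symm e)
    flip-edge (inj₂ (inj₁ (p , q))) = inj₂ (inj₂ (q , p))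
    flip-edge (inj₂ (inj₂ (p , q))) = inj₂ (inj₁ (q , p))

    verts′ : Subset n
    verts′ = verts ∪ ⁅ w ⁆

    w∈′ : w ∈ verts′
    w∈′ = x∈p∪q⁺ (inj₂ (x∈⁅x⁆ w))

    old∈′ : ∀ {v} → v ∈ verts → v ∈ verts′
    old∈′ v∈ = x∈p∪q⁺ (inj₁ v∈)

    in-graph : ∀ {a b} → NewEdge a b → GEdge a b
    in-graph (inj₁ e)                     = edge⊆ e
    in-graph (inj₂ (inj₁ (refl , refl))) = xw
    in-graph (inj₂ (inj₂ (refl , refl))) = Graph.symm G xw

    ends : ∀ {a b} → NewEdge a b → a ∈ verts′ × b ∈ verts′
    ends (inj₁ e)                     = old∈′ (proj₁ (endpoints e)) , old∈′ (proj₂ (endpoints e))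
    ends (inj₂ (inj₁ (refl , refl))) = old∈′ x∈ , w∈′
    ends (inj₂ (inj₂ (refl , refl))) = w∈′ , old∈′ x∈

    H′ : Subgraph G
    H′ = record
      { verts     = verts′
      ; edge      = λ a b → ⌊ newEdge? a b ⌋
      ; symm      = λ {a} {b} e → fromWitness {a? = newEdge? b a} (flip-edge (toWitness {a? = newEdge? a b} e))
      ; edge⊆     = λ {a} {b} e → in-graph (toWitness {a? = newEdge? a b} e)
      ; endpoints = λ {a} {b} e → ends (toWitness {a? = newEdge? a b} e)
      }

    open Subgraph H′ using () renaming (Adj to Adj′)

    to : ∀ {a b} → NewEdge a b → Adj′ a b
    to {a} {b} = fromWitness {a? = newEdge? a b}

    from : ∀ {a b} → Adj′ a b → NewEdge a b
    from {a} {b} = toWitness {a? = newEdge? a b}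

    to-x : ∀ {u} → u ∈ verts′ → Star Adj′ u x
    to-x u∈′ with x∈p∪q⁻ verts ⁅ w ⁆ u∈′
    ... | inj₁ u∈ = Star.gmap (λ v → v) (λ e → to (inj₁ e)) (proj₁ (proj₂ tree) u∈ x∈)
    ... | inj₂ u∈ = to (inj₂ (inj₂ (x∈⁅y⁆⇒x≡y w u∈ , refl))) ◅ ε

    connected′ : Subgraph.Connected H′
    connected′ u∈ v∈ = to-x u∈ ◅◅ Star.reverse (λ e → to (flip-edge (from e))) (to-x v∈)

    after-w : ∀ {b} → Adj′ w b → b ≡ x
    after-w e with from e
    ... | inj₁ e₀                    = ⊥-elim (w∉ (proj₁ (endpoints e₀)))
    ... | inj₂ (inj₁ (w≡x , _))     = ⊥-elim (w∉ (subst (_∈ verts) (sym w≡x) x∈))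
    ... | inj₂ (inj₂ (_ , b≡x))     = b≡x

    before-w : ∀ {a} → Adj′ a w → a ≡ x
    before-w e = after-w (to (flip-edge (from e)))

    old-edge : ∀ {a b} → a ≢ w → b ≢ w → Adj′ a b → Adj a b
    old-edge a≢w b≢w e with from e
    ... | inj₁ e₀                = e₀
    ... | inj₂ (inj₁ (_ , b≡w)) = ⊥-elim (b≢w b≡w)
    ... | inj₂ (inj₂ (a≡w , _)) = ⊥-elim (a≢w a≡w)

    last-link : ∀ b zs {u} → Linked Adj′ ((b ∷ zs) ∷ʳ u) → ∃[ z ] (z ∈ˡ (b ∷ zs) × Adj′ z u)
    last-link b []       (e ∷ _) = b , here refl , e
    last-link b (c ∷ zs) (_ ∷ links) with last-link c zs links
    ... | z , z∈ , e = z , there z∈ , e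

    -- Both neighbours of w on a cycle are x, so w is the only vertex between
    -- two occurrences of x.
    visit-w : ∀ a zs {u} → Unique (a ∷ zs) → Linked Adj′ ((a ∷ zs) ∷ʳ u) → w ∈ˡ zs →
      (a ≡ u × zs ≡ w ∷ []) ⊎ u ∈ˡ zs
    visit-w a (b ∷ []) _ (e₁ ∷ e₂ ∷ _) (here refl) = inj₁ (trans (before-w e₁) (sym (after-w e₂)) , refl)
    visit-w a (b ∷ c ∷ zs) ((_ ∷ a≢c ∷ _) ∷ _) (e₁ ∷ e₂ ∷ _) (here refl) =
      ⊥-elim (a≢c (trans (before-w e₁) (sym (after-w e₂))))
    visit-w a (b ∷ zs) (_ ∷ unique) (_ ∷ links) (there w∈) with visit-w b zs unique links w∈
    ... | inj₁ (b≡u , _) = inj₂ (here (sym b≡u))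
    ... | inj₂ u∈        = inj₂ (there u∈)

    -- If the cycle starts at w, its second and its last vertex are both x, yet they are distinct
    -- because the cycle has at least three vertices. Otherwise `visit-w` leaves a cycle of only two
    -- vertices or a second occurrence of its start.
    misses-w : ∀ u vs → Subgraph.IsCycle H′ u vs → ¬ (w ∈ˡ (u ∷ vs))
    misses-w u []           (() , _) _
    misses-w u (_ ∷ [])     (s≤s () , _) _
    misses-w u (a ∷ b ∷ vs) (_ , _ ∷ (a≢ ∷ _) , e ∷ _ ∷ links) (here refl) with last-link b vs links
    ... | z , z∈ , e′ = All.lookup a≢ z∈ (trans (after-w e) (sym (before-w e′)))
    misses-w u (a ∷ b ∷ vs) (_ , unique@(u≢ ∷ _) , links) (there w∈) with visit-w u (a ∷ b ∷ vs) unique links w∈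
    ... | inj₁ (_ , ())
    ... | inj₂ u∈ = All.lookup u≢ u∈ refl

    old-links : ∀ a zs {u} → u ≢ w → All (_≢ w) (a ∷ zs) → Linked Adj′ ((a ∷ zs) ∷ʳ u) → Linked Adj ((a ∷ zs) ∷ʳ u)
    old-links a []       u≢w (a≢w ∷ _)         (e ∷ _)     = old-edge a≢w u≢w e ∷ [-]
    old-links a (b ∷ zs) u≢w (a≢w ∷ rest@(b≢w ∷ _)) (e ∷ links) = old-edge a≢w b≢w e ∷ old-links b zs u≢w rest links

    acyclic′ : Subgraph.Acyclic H′
    acyclic′ u vs cycle@(long , unique , links) = proj₂ (proj₂ tree) u vs
      (long , unique , old-links u vs (All.head others) others links)
      where
      others : All (_≢ w) (u ∷ vs)
      others = All.tabulate (λ v∈ v≡w → misses-w u vs cycle (subst (_∈ˡ (u ∷ vs)) v≡w v∈))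

    tree′ : Subgraph.IsTree H′
    tree′ = (w , w∈′) , connected′ , acyclic′

  -- A walk may revisit vertices, and its edges may then close cycles. So an edge enters the tree
  -- only if its lower end is not yet there. The `suc` in the count records that `root t` already
  -- belongs to `H`; in the recursion this slack pays for the vertex `root t₂` when it is new.
  graft : ∀ t (H : Subgraph G) → Subgraph.IsTree H → AllEdges GEdge t → root t ∈ Subgraph.verts H →
    ∃[ H′ ] (Subgraph.IsTree H′ × Subgraph.verts H ⊆ Subgraph.verts H′
           × AllVertices (_∈ Subgraph.verts H′) t
           × suc ∣ Subgraph.verts {G = G} H′ ∣ ≤ ∣ Subgraph.verts H ∣ + size t)
  graft (leaf v) H tree edges v∈ =
    H , tree , (λ z∈ → z∈) , v∈ , ≤-reflexive (+-comm 1 ∣ Subgraph.verts H ∣)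
  graft (node t₁ t₂) H tree (r , e₁ , e₂) r∈ with graft t₁ H tree e₁ r∈
  ... | H₁ , tree₁ , H⊆H₁ , all₁ , card₁ with root t₂ ∈? Subgraph.verts H₁
  ...   | yes r₂∈ with graft t₂ H₁ tree₁ e₂ r₂∈
  ...     | H₂ , tree₂ , H₁⊆H₂ , all₂ , card₂ =
    H₂ , tree₂ , (λ z∈ → H₁⊆H₂ (H⊆H₁ z∈)) , (all-map H₁⊆H₂ t₁ all₁ , all₂) ,
    ≤-trans card₂ (≤-trans (+-monoˡ-≤ (size t₂) (≤-trans (n≤1+n _) card₁))
      (≤-reflexive (+-assoc ∣ Subgraph.verts H ∣ (size t₁) (size t₂))))
  graft (node t₁ t₂) H tree (r , e₁ , e₂) r∈ | H₁ , tree₁ , H⊆H₁ , all₁ , card₁ | no r₂∉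
    with graft t₂ L.H′ L.tree′ e₂ L.w∈′
    where module L = AddLeaf H₁ tree₁ (root-all t₁ all₁) r₂∉ r
  ... | H₂ , tree₂ , L⊆H₂ , all₂ , card₂ =
    H₂ , tree₂ , (λ z∈ → L⊆H₂ (x∈p∪q⁺ (inj₁ (H⊆H₁ z∈)))) ,
    (all-map (λ z∈ → L⊆H₂ (x∈p∪q⁺ (inj₁ z∈))) t₁ all₁ , all₂) ,
    ≤-trans card₂ (≤-trans (+-monoˡ-≤ (size t₂) (≤-trans (∣insert∣-≤ (Subgraph.verts H₁) (root t₂)) card₁))
      (≤-reflexive (+-assoc ∣ Subgraph.verts H ∣ (size t₁) (size t₂))))

  tree-of-walk : ∀ t → AllEdges GEdge t →
    ∃[ H ] (Subgraph.IsTree {G = G} H × AllVertices (_∈ Subgraph.verts H) t × ∣ Subgraph.verts H ∣ ≤ size t)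
  tree-of-walk t edges with graft t (singleton (root t)) (singleton-tree (root t)) edges (x∈⁅x⁆ (root t))
  ... | H , tree , _ , all , card =
    H , tree , all , ≤-pred (≤-trans card (≤-reflexive (cong (_+ size t) (∣⁅x⁆∣≡1 (root t)))))

-- The program

-- Cells 0 to 17 hold scalars; the walk counts of the vertices start at cell 18.
pattern rRes = 0
pattern rn = 1
pattern rl = 2
pattern rp = 3
pattern rN = 4
pattern rM = 5
pattern rN-2 = 6
pattern rtot = 7
pattern rx = 8
pattern rk = 9
pattern rv = 10
pattern ru = 11
pattern ry = 12
pattern ra = 13
pattern rs = 14
pattern racc = 15
pattern rt = 16
pattern rh = 17

regs : (res n l p N M N-2 tot x k v u y a s acc t h : ℕ) → Memory → Memory
regs res n l p N M N-2 tot x k v u y a s acc t h arr =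
  res ∷ n ∷ l ∷ p ∷ N ∷ M ∷ N-2 ∷ tot ∷ x ∷ k ∷ v ∷ u ∷ y ∷ a ∷ s ∷ acc ∷ t ∷ h ∷ arr

infix 6 _←_
_←_ : Dest → Operand → Program
d ← x = d ≔ const 0 ⟨ add ⟩ x

-- The machine has no remainder operation, so z mod N is obtained as z - (z / N) · N.
reduceMod : ℕ → Program
reduceMod r =
  reg rh ≔ reg r ⟨ div ⟩ reg rN ⨾
  reg rh ≔ reg rh ⟨ mul ⟩ reg rN ⨾
  reg r ≔ reg r ⟨ sub ⟩ reg rh

-- The binary digits of x, copied to y and consumed from the lowest one, select the
-- groups to avoid.
nextBit avoidStep signStep checkBody : Program
nextBit =
  reg ru ≔ reg ru ⟨ sub ⟩ const 1 ⨾
  reg rh ≔ reg ry ⟨ div ⟩ const 2 ⨾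
  reg rt ≔ reg rh ⟨ add ⟩ reg rh ⨾
  reg rt ≔ reg ry ⟨ sub ⟩ reg rt ⨾
  reg ry ← reg rh ⨾
  reg rh ← const 0
avoidStep =
  reg rh ≔ reg rn ⟨ add ⟩ reg ru ⨾
  reg rh ≔ reg rh ⟨ mul ⟩ reg rn ⨾
  reg rh ≔ reg rh ⟨ add ⟩ reg rv ⨾
  reg rh ≔ const 4 ⟨ add ⟩ reg rh ⨾
  reg rh ≔ input rh ⟨ mul ⟩ reg rt ⨾
  reg rh ≔ const 1 ⟨ sub ⟩ reg rh ⨾
  reg ra ≔ reg ra ⟨ mul ⟩ reg rh ⨾
  reg rh ← const 0
signStep =
  reg rh ≔ reg rt ⟨ mul ⟩ reg rN-2 ⨾
  reg rh ≔ const 1 ⟨ add ⟩ reg rh ⨾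
  reg rs ≔ reg rs ⟨ mul ⟩ reg rh ⨾
  reduceMod rs ⨾
  reg rt ← const 0 ⨾
  reg rh ← const 0
checkBody = nextBit ⨾ avoidStep ⨾ signStep

-- `check` computes into `ra` whether the vertex `rv` lies outside all groups of X, and into `rs`
-- the sign of X. Repeating it at every update costs time proportional to l but no further cells.
check neighbourStep store relax sweep rounds sumStep subsetStep : Program
check =
  reg ry ← reg rx ⨾
  reg ra ← const 1 ⨾
  reg rs ← const 1 ⨾
  reg ru ← reg rl ⨾
  whilenz reg ru loop checkBody ⨾
  reg ry ← const 0
neighbourStep =
  reg ru ≔ reg ru ⟨ sub ⟩ const 1 ⨾
  reg rt ≔ const 18 ⟨ add ⟩ reg ru ⨾
  reg rh ≔ reg rv ⟨ mul ⟩ reg rn ⨾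
  reg rh ≔ reg rh ⟨ add ⟩ reg ru ⨾
  reg rh ≔ const 4 ⟨ add ⟩ reg rh ⨾
  reg rh ≔ input rh ⟨ mul ⟩ ind rt ⨾
  reg racc ≔ reg racc ⟨ add ⟩ reg rh ⨾
  reg rt ← const 0 ⨾
  reg rh ← const 0
store =
  reg rt ≔ const 18 ⟨ add ⟩ reg rv ⨾
  reg racc ≔ ind rt ⟨ mul ⟩ reg racc ⨾
  reg racc ≔ reg racc ⟨ add ⟩ reg rM ⨾
  reg racc ≔ reg racc ⟨ mul ⟩ reg ra ⨾
  reduceMod racc ⨾
  ind rt ← reg racc ⨾
  reg ra ← const 0 ⨾
  reg rs ← const 0 ⨾
  reg racc ← const 0 ⨾
  reg rt ← const 0 ⨾
  reg rh ← const 0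
relax =
  reg rv ≔ reg rv ⟨ sub ⟩ const 1 ⨾
  check ⨾
  reg ru ← reg rn ⨾
  whilenz reg ru loop neighbourStep ⨾
  store
sweep =
  reg rk ≔ reg rk ⟨ sub ⟩ const 1 ⨾
  reg rv ← reg rn ⨾
  whilenz reg rv loop relax
rounds =
  reg rk ← reg rp ⨾
  whilenz reg rk loop sweep
-- Besides summing, this clears the table for the next subset.
sumStep =
  reg rv ≔ reg rv ⟨ sub ⟩ const 1 ⨾
  reg rt ≔ const 18 ⟨ add ⟩ reg rv ⨾
  reg rh ≔ ind rt ⟨ mul ⟩ reg rs ⨾
  reg rtot ≔ reg rtot ⟨ add ⟩ reg rh ⨾
  reduceMod rtot ⨾
  ind rt ← const 0 ⨾
  reg rt ← const 0 ⨾
  reg rh ← const 0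
subsetStep =
  reg rx ≔ reg rx ⟨ sub ⟩ const 1 ⨾
  rounds ⨾
  -- Only the sign in `rs` is wanted here. `rv` is 0 after the rounds, a legitimate vertex, and its
  -- `ra` is discarded.
  check ⨾
  reg ra ← const 0 ⨾
  reg rv ← reg rn ⨾
  whilenz reg rv loop sumStep ⨾
  reg rs ← const 0

readInput powerStep power computeBase computeModulus computeSubsets solve program : Program
readInput =
  -- Writing the last scalar cell first pads the empty memory with zeros to the 18 cells that `regs`
  -- describes.
  reg 17 ← const 0 ⨾
  -- `rRes` still holds 0 and serves as the input index 0.
  reg rn ← input rRes ⨾
  reg rt ← const 1 ⨾
  reg rl ← input rt ⨾
  reg rt ← const 2 ⨾
  reg rh ← input rt ⨾
  reg rt ← const 3 ⨾
  reg rp ← input rt ⨾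
  -- With truncated subtraction, p - (p - n) is the minimum of p and n. The complement of the sign
  -- bit then turns it into 0 for negative p.
  reg rt ≔ reg rp ⟨ sub ⟩ reg rn ⨾
  reg rp ≔ reg rp ⟨ sub ⟩ reg rt ⨾
  reg rh ≔ const 1 ⟨ sub ⟩ reg rh ⨾
  reg rp ≔ reg rp ⟨ mul ⟩ reg rh ⨾
  reg rt ← const 0 ⨾
  reg rh ← const 0
powerStep =
  reg ru ≔ reg ru ⟨ sub ⟩ const 1 ⨾
  reg racc ≔ reg racc ⟨ mul ⟩ reg rt
power =
  reg racc ← const 1 ⨾
  whilenz reg ru loop powerStep
computeBase =
  reg rt ≔ reg rn ⟨ add ⟩ reg rn ⨾
  reg rt ≔ reg rt ⟨ add ⟩ reg rt ⨾
  reg ru ← reg rp ⨾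
  power ⨾
  reg rM ← reg racc
computeModulus =
  reg rt ← reg rM ⨾
  reg ru ≔ const 1 ⟨ add ⟩ reg rp ⨾
  power ⨾
  reg rN ← reg racc ⨾
  -- A digit t contributes the sign 1 + t · (N - 2), which is 1 or N - 1 without any branching.
  reg rN-2 ≔ reg rN ⟨ sub ⟩ const 2
computeSubsets =
  reg rt ← const 2 ⨾
  reg ru ← reg rl ⨾
  power ⨾
  reg rx ← reg racc ⨾
  reg racc ← const 0 ⨾
  reg rt ← const 0
solve =
  computeBase ⨾ computeModulus ⨾ computeSubsets ⨾
  whilenz reg rx loop subsetStep ⨾
  ifnz reg rtot then reg rRes ← const 1 else skip
-- The cap is 0 for p at most 0 and for the empty graph. A tree has a vertex, so the answer is no,
-- and `rRes` already holds 0.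
program = readInput ⨾ ifnz reg rp then solve else skip

start : (n l p : ℕ) → Memory
start n l p = regs 0 n l p 0 0 0 0 0 0 0 0 0 0 0 0 0 0 []

-- Execution and correctness of the program

module Congruence (c : ℕ) where

  infix 4 _~_
  record _~_ (a b : ℕ) : Set where
    constructor congruent
    field remainders : a % suc c ≡ b % suc c
  open _~_ public

  ≡⇒~ : ∀ {a b} → a ≡ b → a ~ b
  ≡⇒~ a≡b = congruent (cong (_% suc c) a≡b)

  ~-refl : ∀ {a} → a ~ a
  ~-refl = congruent refl

  ~-sym : ∀ {a b} → a ~ b → b ~ a
  ~-sym (congruent p) = congruent (sym p)

  ~-trans : ∀ {a b d} → a ~ b → b ~ d → a ~ d
  ~-trans (congruent p) (congruent q) = congruent (trans p q)

  ~-+ : ∀ {a a′ b b′} → a ~ a′ → b ~ b′ → a + b ~ a′ + b′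
  ~-+ {a} {a′} {b} {b′} (congruent p) (congruent q) = congruent (trans (%-distribˡ-+ a b (suc c))
    (trans (cong₂ (λ x y → (x + y) % suc c) p q) (sym (%-distribˡ-+ a′ b′ (suc c)))))

  ~-* : ∀ {a a′ b b′} → a ~ a′ → b ~ b′ → a * b ~ a′ * b′
  ~-* {a} {a′} {b} {b′} (congruent p) (congruent q) = congruent (trans (%-distribˡ-* a b (suc c))
    (trans (cong₂ (λ x y → (x * y) % suc c) p q) (sym (%-distribˡ-* a′ b′ (suc c)))))

  multiple~0 : ∀ k → k * suc c ~ 0
  multiple~0 k = congruent (m*n%n≡0 k (suc c))

  Σ-~ : ∀ {A : Set} (xs : List A) {f g : A → ℕ} → (∀ x → f x ~ g x) → Σ xs f ~ Σ xs g
  Σ-~ []       f~g = ~-refl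
  Σ-~ (x ∷ xs) f~g = ~-+ (f~g x) (Σ-~ xs f~g)

  Σ-<-~ : ∀ n {f g} → (∀ x → x < n → f x ~ g x) → Σ-< n f ~ Σ-< n g
  Σ-<-~ zero    f~g = ~-refl
  Σ-<-~ (suc n) f~g = ~-+ (f~g n ≤-refl) (Σ-<-~ n (λ x x<n → f~g x (m<n⇒m<1+n x<n)))

-- Effect and cost of each piece of the main loop

module Algo (inp : List ℕ) (n l p c M B : ℕ)
  (32≤B : 32 ≤ B) (inp≤B : ∀ i → read inp i ≤ B) (bits : ∀ i → read inp (4 + i) ≤ 1)
  (1≤n : 1 ≤ n) (n≤c : n ≤ c) (M≤c : M ≤ c) (1≤c : 1 ≤ c) (N³≤B : suc c * suc c * suc c ≤ B)
  (index≤B : 4 + (n + l) * n ≤ B) (cells≤B : 18 + n ≤ B) where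

  -- The modulus is nonzero by its form, and c is at once the largest residue and the representative
  -- of - 1.
  N : ℕ
  N = suc c

  modN : ℕ → ℕ
  modN z = z ∸ z / N * N

  modN≤c : ∀ z → modN z ≤ c
  modN≤c z = subst (_≤ c) (m%n≡m∸m/n*n z N) (≤-pred (m%n<n z N))

  -- Both matrices have n columns, so the incidence matrix simply continues the adjacency matrix:
  -- row n + i belongs to group i.
  entry : ℕ → ℕ → ℕ
  entry i j = read inp (4 + (i * n + j))

  open Boxed inp (18 + n) B (m≤m+n 18 n) 32≤B inp≤B public

  -- Executions are stated for exact memories. This is why the program resets its scratch cells:
  -- every iteration must return to a state of the same shape.
  st : (tot x k v u y a s acc t h : ℕ) → Memory → Memory
  st tot x k v u y a s acc t h arr =
    regs 0 n l p N M (c ∸ 1) tot x k v u y a s acc t h arr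

  c≤B : c ≤ B
  c≤B = ≤-trans (≤-trans (n≤1+n c) (≤-trans (m≤m*n N (N * N)) (≤-reflexive (sym (*-assoc N N N))))) N³≤B

  N≤B : N ≤ B
  N≤B = ≤-trans (≤-trans (m≤m*n N (N * N)) (≤-reflexive (sym (*-assoc N N N)))) N³≤B

  N²≤B : N * N ≤ B
  N²≤B = ≤-trans (m≤m*n (N * N) N) N³≤B

  1≤B : 1 ≤ B
  1≤B = ≤-trans (s≤s z≤n) N≤B

  n+l≤B : n + l ≤ B
  n+l≤B = ≤-trans (≤-trans (m≤m*n (n + l) n {{>-nonZero 1≤n}}) (m≤n+m _ 4)) index≤B

  l≤B : l ≤ B
  l≤B = ≤-trans (m≤n+m l n) n+l≤B

  n≤B : n ≤ B
  n≤B = ≤-trans n≤c c≤B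

  half : ℕ → ℕ
  half y = y / 2

  lowBit : ℕ → ℕ
  lowBit y = y ∸ (half y + half y)

  half+half : ∀ y → half y + half y ≤ y
  half+half y = subst (_≤ y) (trans (*-comm (half y) 2) (cong (half y +_) (+-identityʳ _))) (m/n*n≤m y 2)

  lowBit≤1 : ∀ y → lowBit y ≤ 1
  lowBit≤1 y = subst (_≤ 1)
    (trans (m%n≡m∸m/n*n y 2) (cong (y ∸_) (trans (*-comm (half y) 2) (cong (half y +_) (+-identityʳ _)))))
    (≤-pred (m%n<n y 2))

  half≤ : ∀ y → half y ≤ y
  half≤ y = m/n≤m y 2

  row≤ : ∀ {r j R} → r < R → j < n → r * n + j ≤ R * n
  row≤ {r} {j} {R} r<R j<n = ≤-trans (+-monoʳ-≤ (r * n) (<⇒≤ j<n))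
    (≤-trans (≤-reflexive (+-comm (r * n) n)) (*-monoˡ-≤ n r<R))

  -- 1 for digit 0, and N - 1 ≡ - 1 for digit 1.
  signFactor : ℕ → ℕ
  signFactor y = 1 + lowBit y * (c ∸ 1)

  signFactor≤c : ∀ y → signFactor y ≤ c
  signFactor≤c y = ≤-trans (s≤s (*-monoˡ-≤ (c ∸ 1) (lowBit≤1 y)))
    (≤-reflexive (trans (cong suc (+-identityʳ _)) (m+[n∸m]≡n 1≤c)))

  halves : ℕ → ℕ → ℕ
  halves zero    y = y
  halves (suc i) y = halves i (half y)

  -- Digits are consumed from the lowest one while the counter runs down, so the lowest digit of x
  -- belongs to the last group.
  avoidProduct : ℕ → ℕ → ℕ → ℕ → ℕ
  avoidProduct v zero    y a = a
  avoidProduct v (suc i) y a = avoidProduct v i (half y) (a * (1 ∸ entry (n + i) v * lowBit y))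

  signProduct : ℕ → ℕ → ℕ → ℕ
  signProduct zero    y s = s
  signProduct (suc i) y s = signProduct i (half y) (modN (s * signFactor y))

  avoidProduct≤1 : ∀ v i y {a} → a ≤ 1 → avoidProduct v i y a ≤ 1
  avoidProduct≤1 v zero    y a≤1 = a≤1
  avoidProduct≤1 v (suc i) y a≤1 =
    avoidProduct≤1 v i (half y) (*-mono-≤ a≤1 (m∸n≤m 1 (entry (n + i) v * lowBit y)))

  signProduct≤c : ∀ i y {s} → s ≤ c → signProduct i y s ≤ c
  signProduct≤c zero    y s≤c = s≤c
  signProduct≤c (suc i) y {s} s≤c = signProduct≤c i (half y) (modN≤c (s * signFactor y))

  nextBit-exec : ∀ {tot x k v u y a s acc arr} → u ≤ B → y ≤ B →
    Exec nextBit
      (st tot x k v (suc u) y a s acc 0 0 arr)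
      (st tot x k v u (half y) a s acc (lowBit y) 0 arr)
      6
  nextBit-exec {y = y} u≤B y≤B =
    set ru (reg ru) sub (const 1) u≤B ▹
    set rh (reg ry) div (const 2) h≤B ▹
    set rt (reg rh) add (reg rh) (≤-trans (half+half y) y≤B) ▹
    set rt (reg ry) sub (reg rt) (≤-trans (lowBit≤1 y) 1≤B) ▹
    set ry (const 0) add (reg rh) h≤B ▹
    clear rh
    where
    h≤B : half y ≤ B
    h≤B = ≤-trans (half≤ y) y≤B

  avoidStep-exec : ∀ {tot x k v u y a s acc t arr} → v < n → u < l → t ≤ 1 → a ≤ 1 →
    Exec avoidStep
      (st tot x k v u y a s acc t 0 arr)
      (st tot x k v u y (a * (1 ∸ entry (n + u) v * t)) s acc t 0 arr)
      8
  avoidStep-exec {v = v} {u} {t = t} v<n u<l t≤1 a≤1 =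
    set rh (reg rn) add (reg ru) (≤-trans (+-monoʳ-≤ n (<⇒≤ u<l)) n+l≤B) ▹
    set rh (reg rh) mul (reg rn) r≤B ▹
    set rh (reg rh) add (reg rv) (≤-trans (m≤n+m _ 4) i≤B) ▹
    set rh (const 4) add (reg rh) i≤B ▹
    set rh (input rh) mul (reg rt) (≤-trans (*-mono-≤ (bits _) t≤1) 1≤B) ▹
    set rh (const 1) sub (reg rh) (≤-trans (m∸n≤m 1 (entry (n + u) v * t)) 1≤B) ▹
    set ra (reg ra) mul (reg rh) (≤-trans (*-mono-≤ a≤1 (m∸n≤m 1 (entry (n + u) v * t))) 1≤B) ▹
    clear rh
    where
    i≤B : 4 + ((n + u) * n + v) ≤ B
    i≤B = ≤-trans (+-monoʳ-≤ 4 (row≤ (+-monoʳ-< n u<l) v<n)) index≤B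
    r≤B : (n + u) * n ≤ B
    r≤B = ≤-trans (≤-trans (m≤m+n _ _) (m≤n+m _ 4)) i≤B

  signStep-exec : ∀ {tot x k v u y a s acc t arr} → t * (c ∸ 1) < c → s ≤ c →
    Exec signStep
      (st tot x k v u y a s acc t 0 arr)
      (st tot x k v u y a (modN (s * (1 + t * (c ∸ 1)))) acc 0 0 arr)
      8
  signStep-exec {s = s} {t = t} f≤c s≤c =
    set rh (reg rt) mul (reg rN-2) (≤-trans (n≤1+n _) f≤B) ▹
    set rh (const 1) add (reg rh) f≤B ▹
    set rs (reg rs) mul (reg rh) q≤B ▹
    (set rh (reg rs) div (reg rN) (≤-trans (m/n≤m (s * (1 + t * (c ∸ 1))) N) q≤B) ▹
     set rh (reg rh) mul (reg rN) (≤-trans (m/n*n≤m (s * (1 + t * (c ∸ 1))) N) q≤B) ▹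
     set rs (reg rs) sub (reg rh) (≤-trans (modN≤c (s * (1 + t * (c ∸ 1)))) c≤B)) ▹
    clear rt ▹
    clear rh
    where
    f≤B : 1 + t * (c ∸ 1) ≤ B
    f≤B = ≤-trans f≤c c≤B
    q≤B : s * (1 + t * (c ∸ 1)) ≤ B
    q≤B = ≤-trans (*-mono-≤ (≤-trans s≤c (n≤1+n c)) (≤-trans f≤c (n≤1+n c))) N²≤B

  checkBody-exec : ∀ {tot x k v u y a s acc arr} → v < n → u < l → y ≤ B → a ≤ 1 → s ≤ c →
    Exec checkBody
      (st tot x k v (suc u) y a s acc 0 0 arr)
      (st tot x k v u (half y) (a * (1 ∸ entry (n + u) v * lowBit y)) (modN (s * signFactor y)) acc 0 0 arr)
      22
  checkBody-exec {u = u} {y} v<n u<l y≤B a≤1 s≤c =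
    nextBit-exec (≤-trans (<⇒≤ u<l) l≤B) y≤B ▹
    avoidStep-exec v<n u<l (lowBit≤1 y) a≤1 ▹
    signStep-exec (signFactor≤c y) s≤c

  checkLoop-exec : ∀ {tot x k v acc arr} u {y a s} → v < n → u ≤ l → y ≤ B → a ≤ 1 → s ≤ c →
    Exec (whilenz reg ru loop checkBody)
      (st tot x k v u y a s acc 0 0 arr)
      (st tot x k v 0 (halves u y) (avoidProduct v u y a) (signProduct u y s) acc 0 0 arr)
      (u * 23 + 1)
  checkLoop-exec zero    v<n u≤l y≤B a≤1 s≤c = loop-done refl
  checkLoop-exec {v = v} (suc u) {y} {s = s} v<n u≤l y≤B a≤1 s≤c =
    loop-step 1+n≢0 (checkBody-exec v<n u≤l y≤B a≤1 s≤c)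
      (checkLoop-exec u v<n (<⇒≤ u≤l) (≤-trans (half≤ _) y≤B) (*-mono-≤ a≤1 (m∸n≤m 1 (entry (n + u) v * lowBit y))) (modN≤c (s * signFactor y)))

  avoids : ℕ → ℕ → ℕ
  avoids x v = avoidProduct v l x 1

  sign : ℕ → ℕ
  sign x = signProduct l x 1

  avoids≤1 : ∀ x v → avoids x v ≤ 1
  avoids≤1 x v = avoidProduct≤1 v l x ≤-refl

  sign≤c : ∀ x → sign x ≤ c
  sign≤c x = signProduct≤c l x 1≤c

  check-exec : ∀ {tot x k v u y a s acc arr} → v < n → x ≤ B →
    Exec check
      (st tot x k v u y a s acc 0 0 arr)
      (st tot x k v 0 0 (avoids x v) (sign x) acc 0 0 arr)
      (4 + (l * 23 + 1 + 1))
  check-exec v<n x≤B =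
    set ry (const 0) add (reg rx) x≤B ▹
    set ra (const 0) add (const 1) 1≤B ▹
    set rs (const 0) add (const 1) 1≤B ▹
    set ru (const 0) add (reg rl) l≤B ▹
    checkLoop-exec l v<n ≤-refl x≤B ≤-refl 1≤c ▹
    clear ry

  neighbourSum : ℕ → Memory → ℕ → ℕ → ℕ
  neighbourSum v arr zero    acc = acc
  neighbourSum v arr (suc u) acc = neighbourSum v arr u (acc + entry v u * read arr u)

  term≤c : ∀ {arr} v u → All (_≤ c) arr → entry v u * read arr u ≤ c
  term≤c v u arr≤c = ≤-trans (*-mono-≤ (bits _) (read-≤ arr≤c u)) (≤-reflexive (*-identityˡ c))

  -- This maintains the loop invariant acc + u · c ≤ n · c: each neighbour still to come has an
  -- allowance of c, which covers its summand.
  accumulate-≤ : ∀ {b d acc} e → d ≤ c → acc + (c + e) ≤ b → acc + d + e ≤ b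
  accumulate-≤ {b} {d} {acc} e d≤c h =
    ≤-trans (≤-reflexive (+-assoc acc d e)) (≤-trans (+-monoʳ-≤ acc (+-monoˡ-≤ e d≤c)) h)

  neighbourSum-≤ : ∀ {arr} v u {acc b} → All (_≤ c) arr → acc + u * c ≤ b → neighbourSum v arr u acc ≤ b
  neighbourSum-≤ v zero    arr≤c h = ≤-trans (≤-reflexive (sym (+-identityʳ _))) h
  neighbourSum-≤ v (suc u) arr≤c h =
    neighbourSum-≤ v u arr≤c (accumulate-≤ (u * c) (term≤c v u arr≤c) h)

  n*c≤B : n * c ≤ B
  n*c≤B = ≤-trans (*-mono-≤ (≤-trans n≤c (n≤1+n c)) (n≤1+n c)) N²≤B

  -- The largest intermediate value of the main loop. The neighbour sum is not reduced and may reach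
  -- n · c before it is multiplied by a cell; with n ≤ c the result stays below N³, hence the cube
  -- in the bound on B.
  c*nc+M≤B : c * (n * c) + M ≤ B
  c*nc+M≤B = ≤-trans (+-mono-≤ (*-monoʳ-≤ c (*-monoˡ-≤ c n≤c)) M≤c) (≤-trans (m≤m+n _ _) (≤-trans (≤-reflexive (lem c)) N³≤B))
    where
    lem : ∀ c → c * (c * c) + c + (1 + 2 * c + 3 * (c * c)) ≡ suc c * suc c * suc c
    lem = solve-∀

  vertexIndex≤B : ∀ {v u} → v < n → u < n → 4 + (v * n + u) ≤ B
  vertexIndex≤B v<n u<n =
    ≤-trans (+-monoʳ-≤ 4 (row≤ {R = n + l} (≤-trans v<n (m≤m+n n l)) u<n)) index≤B

  cell≤B : ∀ {u} → u < n → 18 + u ≤ B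
  cell≤B u<n = ≤-trans (+-monoʳ-≤ 18 (<⇒≤ u<n)) cells≤B

  neighbourStep-exec : ∀ {tot x k v u y a s acc arr} →
    v < n → u < n → All (_≤ c) arr → acc + suc u * c ≤ n * c →
    Exec neighbourStep
      (st tot x k v (suc u) y a s acc 0 0 arr)
      (st tot x k v u y a s (acc + entry v u * read arr u) 0 0 arr)
      9
  neighbourStep-exec {v = v} {u} v<n u<n arr≤c h =
    set ru (reg ru) sub (const 1) (≤-trans (<⇒≤ u<n) n≤B) ▹
    set rt (const 18) add (reg ru) (cell≤B u<n) ▹
    set rh (reg rv) mul (reg rn) (≤-trans (≤-trans (m≤m+n _ u) (m≤n+m _ 4)) i≤B) ▹
    set rh (reg rh) add (reg ru) (≤-trans (m≤n+m _ 4) i≤B) ▹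
    set rh (const 4) add (reg rh) i≤B ▹
    set rh (input rh) mul (ind rt) (≤-trans (term≤c v u arr≤c) c≤B) ▹
    set racc (reg racc) add (reg rh)
      (≤-trans (≤-trans (m≤m+n _ _) (accumulate-≤ (u * c) (term≤c v u arr≤c) h)) n*c≤B) ▹
    clear rt ▹
    clear rh
    where
    i≤B : 4 + (v * n + u) ≤ B
    i≤B = vertexIndex≤B v<n u<n

  neighbourLoop-exec : ∀ {tot x k v y a s arr} u {acc} →
    v < n → u ≤ n → All (_≤ c) arr → acc + u * c ≤ n * c →
    Exec (whilenz reg ru loop neighbourStep)
      (st tot x k v u y a s acc 0 0 arr)
      (st tot x k v 0 y a s (neighbourSum v arr u acc) 0 0 arr)
      (u * 10 + 1)
  neighbourLoop-exec zero    v<n u≤n arr≤c h = loop-done refl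
  neighbourLoop-exec {v = v} (suc u) v<n u≤n arr≤c h =
    loop-step 1+n≢0 (neighbourStep-exec v<n u≤n arr≤c h)
      (neighbourLoop-exec u v<n (<⇒≤ u≤n) arr≤c (accumulate-≤ (u * c) (term≤c v u arr≤c) h))

  relaxed : ℕ → Memory → ℕ → ℕ
  relaxed x arr v = modN ((read arr v * neighbourSum v arr n 0 + M) * avoids x v)

  relaxed≤c : ∀ x arr v → relaxed x arr v ≤ c
  relaxed≤c x arr v = modN≤c ((read arr v * neighbourSum v arr n 0 + M) * avoids x v)

  store-exec : ∀ {tot x k v acc a s arr} → v < n → All (_≤ c) arr → acc ≤ n * c → a ≤ 1 →
    Exec store
      (st tot x k v 0 0 a s acc 0 0 arr)
      (st tot x k v 0 0 0 0 0 0 0 (write arr v (modN ((read arr v * acc + M) * a))))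
      13
  store-exec {v = v} {acc} {a} {arr = arr} v<n arr≤c acc≤ a≤1 =
    set rt (const 18) add (reg rv) (cell≤B v<n) ▹
    set racc (ind rt) mul (reg racc) (≤-trans (m≤m+n _ M) z≤B) ▹
    set racc (reg racc) add (reg rM) z≤B ▹
    set racc (reg racc) mul (reg ra) za≤B ▹
    (set rh (reg racc) div (reg rN) (≤-trans (m/n≤m ((read arr v * acc + M) * a) N) za≤B) ▹
     set rh (reg rh) mul (reg rN) (≤-trans (m/n*n≤m ((read arr v * acc + M) * a) N) za≤B) ▹
     set racc (reg racc) sub (reg rh) (≤-trans (modN≤c ((read arr v * acc + M) * a)) c≤B)) ▹
    assign (ind rt) (const 0) add (reg racc) (≤-trans (modN≤c ((read arr v * acc + M) * a)) c≤B) (+-monoʳ-< 18 v<n) ▹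
    clear ra ▹
    clear rs ▹
    clear racc ▹
    clear rt ▹
    clear rh
    where
    z≤B : read arr v * acc + M ≤ B
    z≤B = ≤-trans (+-monoˡ-≤ M (*-mono-≤ (read-≤ arr≤c v) acc≤)) c*nc+M≤B
    za≤B : (read arr v * acc + M) * a ≤ B
    za≤B = ≤-trans (*-monoʳ-≤ (read arr v * acc + M) a≤1) (≤-trans (≤-reflexive (*-identityʳ (read arr v * acc + M))) z≤B)

  relaxCost : ℕ
  relaxCost = 1 + (4 + (l * 23 + 1 + 1) + (1 + (n * 10 + 1 + 13)))

  relax-exec : ∀ {tot x k v arr} → v < n → x ≤ B → All (_≤ c) arr →
    Exec relax
      (st tot x k (suc v) 0 0 0 0 0 0 0 arr)
      (st tot x k v 0 0 0 0 0 0 0 (write arr v (relaxed x arr v)))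
      relaxCost
  relax-exec {x = x} {v = v} v<n x≤B arr≤c =
    set rv (reg rv) sub (const 1) (≤-trans (<⇒≤ v<n) n≤B) ▹
    check-exec v<n x≤B ▹
    set ru (const 0) add (reg rn) n≤B ▹
    neighbourLoop-exec n v<n ≤-refl arr≤c ≤-refl ▹
    store-exec v<n arr≤c (neighbourSum-≤ v n arr≤c ≤-refl) (avoids≤1 x v)

  sweepFrom : ℕ → ℕ → Memory → Memory
  sweepFrom x zero    arr = arr
  sweepFrom x (suc v) arr = sweepFrom x v (write arr v (relaxed x arr v))

  sweepFrom-≤ : ∀ x v {arr} → All (_≤ c) arr → All (_≤ c) (sweepFrom x v arr)
  sweepFrom-≤ x zero    arr≤c = arr≤c
  sweepFrom-≤ x (suc v) {arr} arr≤c = sweepFrom-≤ x v (All-write v arr≤c (relaxed≤c x arr v))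

  sweepLoop-exec : ∀ {tot x k} v {arr} → v ≤ n → x ≤ B → All (_≤ c) arr →
    Exec (whilenz reg rv loop relax)
      (st tot x k v 0 0 0 0 0 0 0 arr)
      (st tot x k 0 0 0 0 0 0 0 0 (sweepFrom x v arr))
      (v * suc relaxCost + 1)
  sweepLoop-exec zero    v≤n x≤B arr≤c = loop-done refl
  sweepLoop-exec {x = x} (suc v) {arr} v≤n x≤B arr≤c = weaken (≤-reflexive (sym (+-assoc (suc relaxCost) _ 1)))
    (loop-step 1+n≢0 (relax-exec v≤n x≤B arr≤c)
      (sweepLoop-exec v (<⇒≤ v≤n) x≤B (All-write v arr≤c (relaxed≤c x arr v))))

  sweepCost : ℕ
  sweepCost = 2 + (n * suc relaxCost + 1)

  sweep-exec : ∀ {tot x k arr} → k ≤ B → x ≤ B → All (_≤ c) arr →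
    Exec sweep
      (st tot x (suc k) 0 0 0 0 0 0 0 0 arr)
      (st tot x k 0 0 0 0 0 0 0 0 (sweepFrom x n arr))
      sweepCost
  sweep-exec k≤B x≤B arr≤c =
    set rk (reg rk) sub (const 1) k≤B ▹
    set rv (const 0) add (reg rn) n≤B ▹
    sweepLoop-exec n ≤-refl x≤B arr≤c

  roundsFrom : ℕ → ℕ → Memory → Memory
  roundsFrom x zero    arr = arr
  roundsFrom x (suc k) arr = roundsFrom x k (sweepFrom x n arr)

  roundsFrom-≤ : ∀ x k {arr} → All (_≤ c) arr → All (_≤ c) (roundsFrom x k arr)
  roundsFrom-≤ x zero    arr≤c = arr≤c
  roundsFrom-≤ x (suc k) arr≤c = roundsFrom-≤ x k (sweepFrom-≤ x n arr≤c)

  roundsLoop-exec : ∀ {tot x} k {arr} → k ≤ B → x ≤ B → All (_≤ c) arr →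
    Exec (whilenz reg rk loop sweep)
      (st tot x k 0 0 0 0 0 0 0 0 arr)
      (st tot x 0 0 0 0 0 0 0 0 0 (roundsFrom x k arr))
      (k * suc sweepCost + 1)
  roundsLoop-exec zero    k≤B x≤B arr≤c = loop-done refl
  roundsLoop-exec {x = x} (suc k) k≤B x≤B arr≤c = weaken (≤-reflexive (sym (+-assoc (suc sweepCost) _ 1)))
    (loop-step 1+n≢0 (sweep-exec (<⇒≤ k≤B) x≤B arr≤c)
      (roundsLoop-exec k (<⇒≤ k≤B) x≤B (sweepFrom-≤ x n arr≤c)))

  addTerm : ℕ → ℕ → ℕ → ℕ
  addTerm s tot w = modN (tot + w * s)

  addTerm≤c : ∀ s tot w → addTerm s tot w ≤ c
  addTerm≤c s tot w = modN≤c (tot + w * s)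

  sumFrom : ℕ → ℕ → Memory → ℕ → ℕ
  sumFrom s zero    arr tot = tot
  sumFrom s (suc v) arr tot = sumFrom s v (write arr v 0) (addTerm s tot (read arr v))

  zeroFrom : ℕ → Memory → Memory
  zeroFrom zero    arr = arr
  zeroFrom (suc v) arr = zeroFrom v (write arr v 0)

  sumStep-exec : ∀ {tot x v s arr} → tot ≤ c → v < n → s ≤ c → All (_≤ c) arr →
    Exec sumStep
      (st tot x 0 (suc v) 0 0 0 s 0 0 0 arr)
      (st (addTerm s tot (read arr v)) x 0 v 0 0 0 s 0 0 0 (write arr v 0))
      10
  sumStep-exec {tot} {v = v} {s} {arr} tot≤c v<n s≤c arr≤c =
    set rv (reg rv) sub (const 1) (≤-trans (<⇒≤ v<n) n≤B) ▹
    set rt (const 18) add (reg rv) (cell≤B v<n) ▹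
    set rh (ind rt) mul (reg rs) (≤-trans (m≤n+m _ tot) z≤B) ▹
    set rtot (reg rtot) add (reg rh) z≤B ▹
    (set rh (reg rtot) div (reg rN) (≤-trans (m/n≤m (tot + read arr v * s) N) z≤B) ▹
     set rh (reg rh) mul (reg rN) (≤-trans (m/n*n≤m (tot + read arr v * s) N) z≤B) ▹
     set rtot (reg rtot) sub (reg rh) (≤-trans (modN≤c (tot + read arr v * s)) c≤B)) ▹
    assign (ind rt) (const 0) add (const 0) z≤n (+-monoʳ-< 18 v<n) ▹
    clear rt ▹
    clear rh
    where
    z≤B : tot + read arr v * s ≤ B
    z≤B = ≤-trans (+-mono-≤ tot≤c (*-mono-≤ (≤-trans (read-≤ arr≤c v) (n≤1+n c)) s≤c))
      (≤-trans (m≤n+m _ 1) (≤-trans (≤-reflexive (lem c)) N²≤B))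
      where
      lem : ∀ c → 1 + (c + suc c * c) ≡ suc c * suc c
      lem = solve-∀

  sumLoop-exec : ∀ {x s} v {tot arr} → tot ≤ c → v ≤ n → s ≤ c → All (_≤ c) arr →
    Exec (whilenz reg rv loop sumStep)
      (st tot x 0 v 0 0 0 s 0 0 0 arr)
      (st (sumFrom s v arr tot) x 0 0 0 0 0 s 0 0 0 (zeroFrom v arr))
      (v * 11 + 1)
  sumLoop-exec zero    tot≤c v≤n s≤c arr≤c = loop-done refl
  sumLoop-exec {s = s} (suc v) {tot} {arr} tot≤c v≤n s≤c arr≤c =
    loop-step 1+n≢0 (sumStep-exec tot≤c v≤n s≤c arr≤c)
      (sumLoop-exec v (addTerm≤c s tot (read arr v)) (<⇒≤ v≤n) s≤c (All-write v arr≤c z≤n))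

  sumFrom-≤ : ∀ s v {arr tot} → tot ≤ c → sumFrom s v arr tot ≤ c
  sumFrom-≤ s zero    tot≤c = tot≤c
  sumFrom-≤ s (suc v) {arr} {tot} tot≤c = sumFrom-≤ s v (addTerm≤c s tot (read arr v))

  zeroFrom-≤ : ∀ v {arr} → All (_≤ c) arr → All (_≤ c) (zeroFrom v arr)
  zeroFrom-≤ zero    arr≤c = arr≤c
  zeroFrom-≤ (suc v) arr≤c = zeroFrom-≤ v (All-write v arr≤c z≤n)

  subsetCost : ℕ
  subsetCost = 1 + (1 + (p * suc sweepCost + 1) + (4 + (l * 23 + 1 + 1) + (2 + (n * 11 + 1 + 1))))

  subsetStep-exec : ∀ {tot x arr} → p ≤ B → tot ≤ c → x ≤ B → All (_≤ c) arr →
    Exec subsetStep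
      (st tot (suc x) 0 0 0 0 0 0 0 0 0 arr)
      (st (sumFrom (sign x) n (roundsFrom x p arr) tot) x 0 0 0 0 0 0 0 0 0 (zeroFrom n (roundsFrom x p arr)))
      subsetCost
  subsetStep-exec {x = x} p≤B tot≤c x≤B arr≤c =
    set rx (reg rx) sub (const 1) x≤B ▹
    (set rk (const 0) add (reg rp) p≤B ▹
     roundsLoop-exec p p≤B x≤B arr≤c) ▹
    check-exec 1≤n x≤B ▹
    clear ra ▹
    set rv (const 0) add (reg rn) n≤B ▹
    sumLoop-exec n tot≤c ≤-refl (sign≤c x) (roundsFrom-≤ x p arr≤c) ▹
    clear rs

  subsetsTotal : ℕ → Memory → ℕ → ℕ
  subsetsTotal zero    arr tot = tot
  subsetsTotal (suc x) arr tot =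
    subsetsTotal x (zeroFrom n (roundsFrom x p arr)) (sumFrom (sign x) n (roundsFrom x p arr) tot)

  subsetsMemory : ℕ → Memory → Memory
  subsetsMemory zero    arr = arr
  subsetsMemory (suc x) arr = subsetsMemory x (zeroFrom n (roundsFrom x p arr))

  subsetsLoop-exec : ∀ x {tot arr} → p ≤ B → tot ≤ c → x ≤ B → All (_≤ c) arr →
    Exec (whilenz reg rx loop subsetStep)
      (st tot x 0 0 0 0 0 0 0 0 0 arr)
      (st (subsetsTotal x arr tot) 0 0 0 0 0 0 0 0 0 0 (subsetsMemory x arr))
      (x * suc subsetCost + 1)
  subsetsLoop-exec zero    p≤B tot≤c x≤B arr≤c = loop-done refl
  subsetsLoop-exec (suc x) p≤B tot≤c x≤B arr≤c = weaken (≤-reflexive (sym (+-assoc (suc subsetCost) _ 1)))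
    (loop-step 1+n≢0 (subsetStep-exec p≤B tot≤c (<⇒≤ x≤B) arr≤c)
      (subsetsLoop-exec x p≤B (sumFrom-≤ (sign x) n tot≤c) (<⇒≤ x≤B) (zeroFrom-≤ n (roundsFrom-≤ x p arr≤c))))

  -- The meaning of the table modulo N

  module Correctness (M≡ : M ≡ Families.D n ^ p) (N≡ : suc c ≡ M ^ suc p) where

    open Congruence c
    open Families n

    modN~ : ∀ z → modN z ~ z
    modN~ z = ~-trans (≡⇒~ (sym (m%n≡m∸m/n*n z N))) (congruent (m%n%n≡m%n z N))

    member : ℕ → ℕ → ℕ
    member i v = entry (n + i) v

    avoiding : ℕ → ℕ → ℕ → ℕ
    avoiding zero    y v = 1
    avoiding (suc i) y v = (1 ∸ member i v * lowBit y) * avoiding i (half y) v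

    signed : ℕ → ℕ → ℕ
    signed zero    y = 1
    signed (suc i) y = signFactor y * signed i (half y)

    avoidProduct-correct : ∀ v i y a → avoidProduct v i y a ≡ a * avoiding i y v
    avoidProduct-correct v zero    y a = sym (*-identityʳ a)
    avoidProduct-correct v (suc i) y a =
      trans (avoidProduct-correct v i (half y) (a * (1 ∸ member i v * lowBit y)))
        (*-assoc a (1 ∸ member i v * lowBit y) (avoiding i (half y) v))

    signProduct-correct : ∀ i y s → signProduct i y s ~ s * signed i y
    signProduct-correct zero    y s = ≡⇒~ (sym (*-identityʳ s))
    signProduct-correct (suc i) y s =
      ~-trans (signProduct-correct i (half y) (modN (s * signFactor y)))
        (~-trans (~-* (modN~ (s * signFactor y)) ~-refl) (≡⇒~ (*-assoc s (signFactor y) (signed i (half y)))))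

    missed : ℕ → Walk ℕ → ℕ
    missed i = weight (λ v → 1 ∸ member i v)

    -- A missed group contributes the factor 1 + c = N ≡ 0.
    groupProduct : ℕ → Walk ℕ → ℕ
    groupProduct zero    t = 1
    groupProduct (suc i) t = (1 + c * missed i t) * groupProduct i t

    half-double : ∀ y → half (y + y) ≡ y
    half-double y = trans (cong half (trans (cong (y +_) (sym (+-identityʳ y))) (*-comm 2 y))) (m*n/n≡m y 2)

    half-suc-double : ∀ y → half (suc (y + y)) ≡ y
    half-suc-double y =
      trans (cong (λ z → half (suc z)) (trans (cong (y +_) (sym (+-identityʳ y))) (*-comm 2 y)))
        (trans (+-distrib-/ 1 (y * 2) (subst (λ z → 1 + z < 2) (sym (m*n%n≡0 y 2)) ≤-refl)) (m*n/n≡m y 2))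

    lowBit-double : ∀ y → lowBit (y + y) ≡ 0
    lowBit-double y rewrite half-double y = n∸n≡0 (y + y)

    lowBit-suc-double : ∀ y → lowBit (suc (y + y)) ≡ 1
    lowBit-suc-double y rewrite half-suc-double y = m+n∸n≡m 1 (y + y)

    signFactor-1 : 1 + 1 * (c ∸ 1) ≡ c
    signFactor-1 = trans (cong suc (+-identityʳ (c ∸ 1))) (m+[n∸m]≡n 1≤c)

    -- `weight` is multiplicative in its vertex function, so the sum factors over the groups. Digit
    -- 0 of a group gives the factor 1 and digit 1 gives c times `missed`. This is an exact
    -- identity; residues come in later, in `groupProduct~hits`.
    inclusion-exclusion : ∀ i t →
      Σ-< (2 ^ i) (λ x → signed i x * weight (avoiding i x) t) ≡ groupProduct i t
    inclusion-exclusion zero    t = trans (+-identityʳ _) (trans (+-identityʳ _) (weight-const t))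
    inclusion-exclusion (suc i) t = begin
      Σ-< (2 ^ i + (2 ^ i + 0)) F
        ≡⟨ cong (λ m → Σ-< (2 ^ i + m) F) (+-identityʳ (2 ^ i)) ⟩
      Σ-< (2 ^ i + 2 ^ i) F
        ≡⟨ Σ-<-double (2 ^ i) F ⟩
      Σ-< (2 ^ i) (λ y → F (y + y) + F (suc (y + y)))
        ≡⟨ Σ-cong (downFrom (2 ^ i)) pair ⟩
      Σ-< (2 ^ i) (λ y → (1 + c * missed i t) * (signed i y * weight (avoiding i y) t))
        ≡⟨ Σ-*ˡ (downFrom (2 ^ i)) (1 + c * missed i t) (λ y → signed i y * weight (avoiding i y) t) ⟩
      (1 + c * missed i t) * Σ-< (2 ^ i) (λ y → signed i y * weight (avoiding i y) t)
        ≡⟨ cong ((1 + c * missed i t) *_) (inclusion-exclusion i t) ⟩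
      groupProduct (suc i) t ∎
      where
      open ≡-Reasoning
      F : ℕ → ℕ
      F x = signed (suc i) x * weight (avoiding (suc i) x) t
      -- `F` with the lowest digit and the half of its argument abstracted, so that both can be
      -- replaced at 2y and at 2y + 1.
      value′ : ℕ → ℕ → ℕ
      value′ b y = (1 + b * (c ∸ 1)) * signed i y * weight (λ v → (1 ∸ member i v * b) * avoiding i y v) t
      F-value : ∀ x {b y} → lowBit x ≡ b → half x ≡ y → F x ≡ value′ b y
      F-value x refl refl = refl
      even : ∀ y → weight (λ v → 1 ∸ member i v * 0) t ≡ 1
      even y = trans (weight-cong t (λ v → cong (1 ∸_) (*-zeroʳ (member i v)))) (weight-const t)
      odd : weight (λ v → 1 ∸ member i v * 1) t ≡ missed i t
      odd = weight-cong t (λ v → cong (1 ∸_) (*-identityʳ (member i v)))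
      split : ∀ b y → value′ b y ≡
        (1 + b * (c ∸ 1)) * signed i y * (weight (λ v → 1 ∸ member i v * b) t * weight (avoiding i y) t)
      split b y = cong ((1 + b * (c ∸ 1)) * signed i y *_) (weight-* (λ v → 1 ∸ member i v * b) (avoiding i y) t)
      ring : ∀ c m s w → 1 * s * (1 * w) + c * s * (m * w) ≡ (1 + c * m) * (s * w)
      ring = solve-∀
      pair : ∀ y → F (y + y) + F (suc (y + y)) ≡ (1 + c * missed i t) * (signed i y * weight (avoiding i y) t)
      pair y = begin
        F (y + y) + F (suc (y + y))
          ≡⟨ cong₂ _+_ (trans (F-value (y + y) (lowBit-double y) (half-double y)) (split 0 y))
                       (trans (F-value (suc (y + y)) (lowBit-suc-double y) (half-suc-double y)) (split 1 y)) ⟩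
        _ ≡⟨ cong₂ _+_ (cong (λ w → 1 * signed i y * (w * weight (avoiding i y) t)) (even y))
                       (cong₂ (λ k w → k * signed i y * (w * weight (avoiding i y) t)) signFactor-1 odd) ⟩
        1 * signed i y * (1 * weight (avoiding i y) t) + c * signed i y * (missed i t * weight (avoiding i y) t)
          ≡⟨ ring c (missed i t) (signed i y) (weight (avoiding i y) t) ⟩
        (1 + c * missed i t) * (signed i y * weight (avoiding i y) t) ∎

    private variable
      arr : Memory
      L : Family

    presence : ℕ → ℕ → ℕ
    presence x = avoiding l x

    avoids-correct : ∀ x v → avoids x v ≡ presence x v
    avoids-correct x v = trans (avoidProduct-correct v l x 1) (*-identityˡ _)

    term : ℕ → Walk ℕ → ℕ
    term x t = M ^ size t * (edgeWeight entry t * weight (presence x) t)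

    -- The invariant of the main loop: a cell holds the generating function of its list evaluated at
    -- M, up to multiples of N. The graph and X enter only through `term`.
    Represents : ℕ → Memory → Family → Set
    Represents x arr L = ∀ w → w < n → read arr w ~ Σ (L w) (term x)

    neighbourSum-correct : ∀ v arr u acc →
      neighbourSum v arr u acc ≡ acc + Σ-< u (λ w → entry v w * read arr w)
    neighbourSum-correct v arr zero    acc = sym (+-identityʳ acc)
    neighbourSum-correct v arr (suc u) acc =
      trans (neighbourSum-correct v arr u (acc + entry v u * read arr u)) (+-assoc acc _ _)

    term-node : ∀ x {v u} t₁ t₂ → root t₁ ≡ v → root t₂ ≡ u →
      term x (node t₁ t₂) ≡ term x t₁ * (presence x v * entry v u * term x t₂)
    term-node x t₁ t₂ refl refl =
      trans (cong (_* (edgeWeight entry (node t₁ t₂) * weight (presence x) (node t₁ t₂)))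
                  (^-distribˡ-+-* M (size t₁) (size t₂)))
        (lem (M ^ size t₁) (M ^ size t₂) (entry (root t₁) (root t₂)) (edgeWeight entry t₁) (edgeWeight entry t₂)
             (presence x (root t₁)) (weight (presence x) t₁) (weight (presence x) t₂))
      where
      lem : ∀ m₁ m₂ e e₁ e₂ a w₁ w₂ →
        m₁ * m₂ * (e * (e₁ * e₂) * (a * (w₁ * w₂))) ≡ m₁ * (e₁ * w₁) * (a * e * (m₂ * (e₂ * w₂)))
      lem = solve-∀

    Σ-grafts-term : ∀ x v → Rooted L →
      Σ (grafts L v n) (term x) ≡
      Σ (L v) (term x) * Σ-< n (λ u → entry v u * Σ (L u) (term x)) * presence x v
    Σ-grafts-term {L} x v rooted = begin
      Σ (grafts L v n) (term x)
        ≡⟨ Σ-grafts L v n (term x) ⟩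
      Σ-< n (λ u → Σ (L v) (λ t₁ → Σ (L u) (λ t₂ → term x (node t₁ t₂))))
        ≡⟨ Σ-cong (downFrom n) pairs ⟩
      Σ-< n (λ u → W v * presence x v * (entry v u * W u))
        ≡⟨ Σ-*ˡ (downFrom n) (W v * presence x v) (λ u → entry v u * W u) ⟩
      W v * presence x v * Σ-< n (λ u → entry v u * W u)
        ≡⟨ swap (W v) (presence x v) _ ⟩
      W v * Σ-< n (λ u → entry v u * W u) * presence x v ∎
      where
      open ≡-Reasoning
      W : ℕ → ℕ
      W u = Σ (L u) (term x)
      swap : ∀ a b c → a * b * c ≡ a * c * b
      swap = solve-∀
      regroup : ∀ w a e z → w * (a * e * z) ≡ w * a * (e * z)
      regroup = solve-∀
      pairs : ∀ u → Σ (L v) (λ t₁ → Σ (L u) (λ t₂ → term x (node t₁ t₂))) ≡ W v * presence x v * (entry v u * W u)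
      pairs u = begin
        Σ (L v) (λ t₁ → Σ (L u) (λ t₂ → term x (node t₁ t₂)))
          ≡⟨ Σ-congᴬ (rooted v) (λ t₁ r₁ → Σ-congᴬ (rooted u) (λ t₂ r₂ → term-node x t₁ t₂ r₁ r₂)) ⟩
        Σ (L v) (λ t₁ → Σ (L u) (λ t₂ → term x t₁ * (presence x v * entry v u * term x t₂)))
          ≡⟨ Σ-cong (L v) (λ t₁ → trans (Σ-*ˡ (L u) (term x t₁) _)
                                        (cong (term x t₁ *_) (Σ-*ˡ (L u) (presence x v * entry v u) (term x)))) ⟩
        Σ (L v) (λ t₁ → term x t₁ * (presence x v * entry v u * W u))
          ≡⟨ Σ-*ʳ (L v) (presence x v * entry v u * W u) (term x) ⟩
        W v * (presence x v * entry v u * W u)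
          ≡⟨ regroup (W v) (presence x v) (entry v u) (W u) ⟩
        W v * presence x v * (entry v u * W u) ∎

    relaxed-correct : ∀ x v → v < n → Rooted L → Represents x arr L →
      relaxed x arr v ~ Σ (leaf v ∷ grafts L v n) (term x)
    relaxed-correct {L} {arr} x v v<n rooted rep =
      ~-trans (modN~ ((read arr v * neighbourSum v arr n 0 + M) * avoids x v))
      (~-trans (≡⇒~ (cong₂ (λ s a → (read arr v * s + M) * a) (neighbourSum-correct v arr n 0) (avoids-correct x v)))
      (~-trans (~-* (~-+ (~-* (rep v v<n) (Σ-<-~ n (λ u u<n → ~-* (~-refl {entry v u}) (rep u u<n)))) ~-refl) ~-refl)
      (≡⇒~ (trans (lem (W v * Σ-< n (λ u → entry v u * W u)) M (presence x v))
        (cong₂ _+_ (cong₂ _*_ (sym (*-identityʳ M)) (sym (*-identityˡ (presence x v)))) (sym (Σ-grafts-term x v rooted)))))))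
      where
      W : ℕ → ℕ
      W u = Σ (L u) (term x)
      lem : ∀ g m a → (g + m) * a ≡ m * a + g * a
      lem = solve-∀

    relax-represents : ∀ x v → v < n → Rooted L → Represents x arr L →
      Represents x (write arr v (relaxed x arr v)) (extend L v)
    relax-represents {L} {arr} x v v<n rooted rep w w<n with w ≟ v
    ... | yes refl = ~-trans (≡⇒~ (read-write-≡ arr v _)) (relaxed-correct {arr = arr} x v v<n rooted rep)
    ... | no w≢v   = ~-trans (≡⇒~ (read-write-≢ arr _ (λ v≡w → w≢v (sym v≡w)))) (rep w w<n)

    sweep-represents : ∀ x v → v ≤ n → Rooted L → Represents x arr L →
      Represents x (sweepFrom x v arr) (sweepWalks v L)
    sweep-represents x zero    v≤n rooted rep = rep
    sweep-represents {arr = arr} x (suc v) v<n rooted rep =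
      sweep-represents x v (<⇒≤ v<n) (extend-rooted _ v v<n rooted) (relax-represents {arr = arr} x v v<n rooted rep)

    rounds-represents : ∀ x k → Rooted L → Represents x arr L →
      Represents x (roundsFrom x k arr) (roundsWalks k L)
    rounds-represents x zero    rooted rep = rep
    rounds-represents x (suc k) rooted rep =
      rounds-represents x k (sweep-preserves extend-rooted n ≤-refl rooted) (sweep-represents x n ≤-refl rooted rep)

    sumFrom-correct : ∀ s v arr tot → sumFrom s v arr tot ~ tot + Σ-< v (λ w → read arr w * s)
    sumFrom-correct s zero    arr tot = ≡⇒~ (sym (+-identityʳ tot))
    sumFrom-correct s (suc v) arr tot =
      ~-trans (sumFrom-correct s v (write arr v 0) (addTerm s tot (read arr v)))
      (~-trans (~-+ (modN~ (tot + read arr v * s))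
        (≡⇒~ (Σ-<-cong v (λ w w<v → cong (_* s) (read-write-≢ arr 0 (λ v≡w → <⇒≢ w<v (sym v≡w)))))))
      (≡⇒~ (+-assoc tot _ _)))

    -- Zeros represent the empty lists from which the rounds start, so each set X must find a
    -- cleared table.
    Zeroed : Memory → Set
    Zeroed arr = ∀ w → w < n → read arr w ≡ 0

    zeroFrom-correct : ∀ v arr → (∀ w → w < n → v ≤ w → read arr w ≡ 0) → Zeroed (zeroFrom v arr)
    zeroFrom-correct zero    arr h w w<n = h w w<n z≤n
    zeroFrom-correct (suc v) arr h = zeroFrom-correct v (write arr v 0) h′
      where
      h′ : ∀ w → w < n → v ≤ w → read (write arr v 0) w ≡ 0
      h′ w w<n v≤w with v ≟ w
      ... | yes refl = read-write-≡ arr v 0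
      ... | no v≢w   = trans (read-write-≢ arr 0 v≢w) (h w w<n (≤∧≢⇒< v≤w v≢w))

    subsetTerm : ℕ → ℕ
    subsetTerm x = Σ-< n (λ v → Σ (walks p v) (λ t → signed l x * term x t))

    subset-correct : ∀ x arr tot → Zeroed arr →
      sumFrom (sign x) n (roundsFrom x p arr) tot ~ tot + subsetTerm x
    subset-correct x arr tot zeroed =
      ~-trans (sumFrom-correct (sign x) n (roundsFrom x p arr) tot)
      (~-+ (~-refl {tot}) (~-trans (Σ-<-~ n (λ v v<n → ~-* (rep v v<n) sign~))
        (≡⇒~ (Σ-cong (downFrom n) (λ v → trans (*-comm (Σ (walks p v) (term x)) (signed l x)) (sym (Σ-*ˡ (walks p v) (signed l x) (term x))))))))
      where
      rep : Represents x (roundsFrom x p arr) (walks p)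
      rep = rounds-represents x p (λ _ → []) (λ w w<n → ≡⇒~ (zeroed w w<n))
      sign~ : sign x ~ signed l x
      sign~ = ~-trans (signProduct-correct l x 1) (≡⇒~ (*-identityˡ (signed l x)))

    subsetsTotal-correct : ∀ x arr tot → Zeroed arr → subsetsTotal x arr tot ~ tot + Σ-< x subsetTerm
    subsetsTotal-correct zero    arr tot zeroed = ≡⇒~ (sym (+-identityʳ tot))
    subsetsTotal-correct (suc x) arr tot zeroed =
      ~-trans (subsetsTotal-correct x (zeroFrom n (roundsFrom x p arr)) (sumFrom (sign x) n (roundsFrom x p arr) tot)
                (zeroFrom-correct n (roundsFrom x p arr) (λ w w<n n≤w → ⊥-elim (<⇒≱ w<n n≤w))))
      (~-trans (~-+ (subset-correct x arr tot zeroed) ~-refl) (≡⇒~ (+-assoc tot _ _)))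

    fullTerm : Walk ℕ → ℕ
    fullTerm t = M ^ size t * (edgeWeight entry t * groupProduct l t)

    -- The lists `walks p v` do not depend on X. The sum over X can therefore move inside, where
    -- `inclusion-exclusion` applies to each walk separately.
    Σ-subsetTerm : Σ-< (2 ^ l) subsetTerm ≡ Σ-< n (λ v → Σ (walks p v) fullTerm)
    Σ-subsetTerm = begin
      Σ-< (2 ^ l) subsetTerm
        ≡⟨ Σ-swap (downFrom (2 ^ l)) (downFrom n) _ ⟩
      Σ-< n (λ v → Σ-< (2 ^ l) (λ x → Σ (walks p v) (λ t → signed l x * term x t)))
        ≡⟨ Σ-cong (downFrom n) (λ v → trans (Σ-swap (downFrom (2 ^ l)) (walks p v) _) (Σ-cong (walks p v) per-walk)) ⟩
      Σ-< n (λ v → Σ (walks p v) fullTerm) ∎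
      where
      open ≡-Reasoning
      lem : ∀ s m e w → s * (m * (e * w)) ≡ m * e * (s * w)
      lem = solve-∀
      per-walk : ∀ t → Σ-< (2 ^ l) (λ x → signed l x * term x t) ≡ fullTerm t
      per-walk t = begin
        Σ-< (2 ^ l) (λ x → signed l x * term x t)
          ≡⟨ Σ-cong (downFrom (2 ^ l)) (λ x → lem (signed l x) (M ^ size t) (edgeWeight entry t) (weight (presence x) t)) ⟩
        Σ-< (2 ^ l) (λ x → M ^ size t * edgeWeight entry t * (signed l x * weight (presence x) t))
          ≡⟨ Σ-*ˡ (downFrom (2 ^ l)) (M ^ size t * edgeWeight entry t) _ ⟩
        M ^ size t * edgeWeight entry t * Σ-< (2 ^ l) (λ x → signed l x * weight (presence x) t)
          ≡⟨ cong (M ^ size t * edgeWeight entry t *_) (inclusion-exclusion l t) ⟩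
        M ^ size t * edgeWeight entry t * groupProduct l t
          ≡⟨ *-assoc (M ^ size t) (edgeWeight entry t) (groupProduct l t) ⟩
        fullTerm t ∎

    hits : ℕ → Walk ℕ → ℕ
    hits zero    t = 1
    hits (suc i) t = (1 ∸ missed i t) * hits i t

    missed≤1 : ∀ i t → missed i t ≤ 1
    missed≤1 i t = weight-≤1 t (λ v → m∸n≤m 1 (member i v))

    groupProduct~hits : ∀ i t → groupProduct i t ~ hits i t
    groupProduct~hits zero    t = ~-refl
    groupProduct~hits (suc i) t = ~-* (factor (missed i t) (missed≤1 i t)) (groupProduct~hits i t)
      where
      factor : ∀ m → m ≤ 1 → 1 + c * m ~ 1 ∸ m
      factor 0 _ = ≡⇒~ (cong suc (*-zeroʳ c))
      factor 1 _ = ~-trans (≡⇒~ (lem c)) (multiple~0 1)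
        where
        lem : ∀ c → 1 + c * 1 ≡ 1 * suc c
        lem = solve-∀
      factor (suc (suc _)) (s≤s ())

    -- For s above q the power is a multiple of M ^ (q + 1) = N, so both sides vanish modulo N.
    power~within : ∀ q s → M ^ suc q ≡ N → M ^ s ~ M ^ s * within q s
    power~within q s M^≡N with s ≤? q
    ... | yes s≤q = ≡⇒~ (sym (trans (cong (M ^ s *_) (within-≤ s≤q)) (*-identityʳ (M ^ s))))
    ... | no s≰q  =
      ~-trans (~-trans (≡⇒~ M^s≡) (multiple~0 (M ^ (s ∸ suc q))))
        (~-sym (~-trans (~-* (~-trans (≡⇒~ M^s≡) (multiple~0 (M ^ (s ∸ suc q)))) ~-refl) ~-refl))
      where
      M^s≡ : M ^ s ≡ M ^ (s ∸ suc q) * N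
      M^s≡ = trans (cong (M ^_) (sym (m∸n+n≡m (≰⇒> s≰q))))
        (trans (^-distribˡ-+-* M (s ∸ suc q) (suc q)) (cong (M ^ (s ∸ suc q) *_) M^≡N))

    goodTerm : Walk ℕ → ℕ
    goodTerm t = M ^ size t * within p (size t) * (edgeWeight entry t * hits l t)

    total : ℕ
    total = Σ-< n (λ v → Σ (walks p v) goodTerm)

    fullTerm~goodTerm : ∀ t → fullTerm t ~ goodTerm t
    fullTerm~goodTerm t = ~-* (power~within p (size t) (sym N≡)) (~-* (~-refl {edgeWeight entry t}) (groupProduct~hits l t))

    hits-≤1 : ∀ i t → hits i t ≤ 1
    hits-≤1 zero    t = ≤-refl
    hits-≤1 (suc i) t = *-mono-≤ (m∸n≤m 1 (missed i t)) (hits-≤1 i t)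

    1≤M : 1 ≤ M
    1≤M = subst (1 ≤_) (sym M≡) (1≤D^ 1≤n p)

    entry≤1 : ∀ u v → entry u v ≤ 1
    entry≤1 u v = bits (u * n + v)

    goodTerm-≤ : ∀ t → goodTerm t ≤ M ^ p * within p (size t)
    goodTerm-≤ t = ≤-trans
      (*-monoʳ-≤ (M ^ size t * within p (size t)) (*-mono-≤ (edgeWeight-≤1 t entry≤1) (hits-≤1 l t)))
      (≤-trans (≤-reflexive (*-identityʳ _)) (power-≤ (size t)))
      where
      power-≤ : ∀ s → M ^ s * within p s ≤ M ^ p * within p s
      power-≤ s with s ≤? p
      ... | yes s≤p = *-monoˡ-≤ (within p s) (^-monoʳ-≤ M {{>-nonZero 1≤M}} s≤p)
      ... | no s≰p with within p s in eq
      ...   | zero  = ≤-reflexive (trans (*-zeroʳ (M ^ s)) (sym (*-zeroʳ (M ^ p))))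
      ...   | suc _ = ⊥-elim (s≰p (within-≢0 p s (λ w≡0 → 1+n≢0 (trans (sym eq) w≡0))))

    -- Each walk contributes at most M ^ p, and `count-walks` leaves fewer than D ^ p = M
    -- contributing walks, so the total is below M ^ (p + 1).
    total<N : total < N
    total<N = begin-strict
      total
        ≤⟨ Σ-mono (downFrom n) (λ v → ≤-trans (Σ-mono (walks p v) goodTerm-≤) (≤-reflexive (Σ-*ˡ (walks p v) (M ^ p) _))) ⟩
      Σ-< n (λ v → M ^ p * Σ (walks p v) (λ t → within p (size t)))
        ≡⟨ Σ-*ˡ (downFrom n) (M ^ p) _ ⟩
      M ^ p * Σ-< n (λ v → Σ (walks p v) (λ t → within p (size t)))
        <⟨ *-monoʳ-< (M ^ p) {{>-nonZero (m^n>0 M {{>-nonZero 1≤M}} p)}} (subst (_ <_) (sym M≡) (count-walks 1≤n p p)) ⟩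
      M ^ p * M
        ≡⟨ trans (*-comm (M ^ p) M) (sym N≡) ⟩
      N ∎
      where open ≤-Reasoning

    -- Both numbers are below N, so their congruence is an equality.
    subsetsTotal-≡ : subsetsTotal (2 ^ l) [] 0 ≡ total
    subsetsTotal-≡ = begin
      S             ≡⟨ sym (m<n⇒m%n≡m (s≤s (subsetsTotal≤c (2 ^ l) z≤n))) ⟩
      S % N         ≡⟨ remainders (~-trans (subsetsTotal-correct (2 ^ l) [] 0 (λ _ _ → refl))
                         (~-trans (≡⇒~ Σ-subsetTerm) (Σ-~ (downFrom n) (λ v → Σ-~ (walks p v) fullTerm~goodTerm)))) ⟩
      total % N     ≡⟨ m<n⇒m%n≡m total<N ⟩
      total         ∎
      where
      open ≡-Reasoning
      S : ℕ
      S = subsetsTotal (2 ^ l) [] 0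
      subsetsTotal≤c : ∀ x {arr tot} → tot ≤ c → subsetsTotal x arr tot ≤ c
      subsetsTotal≤c zero    h = h
      subsetsTotal≤c (suc x) h = subsetsTotal≤c x (sumFrom-≤ (sign x) n h)

    -- From the total to the existence of a walk

    module Decision (edge : Fin n → Fin n → Bool) (group : Fin l → Subset n)
      (edge-entry : ∀ u v → entry (toℕ u) (toℕ v) ≡ bit (edge u v))
      (group-entry : ∀ i v → member (toℕ i) (toℕ v) ≡ bit (lookup (group i) v)) where

      GoodWalk : Walk (Fin n) → Set
      GoodWalk t = AllEdges (λ u v → T (edge u v)) t × size t ≤ p × (∀ i → AnyVertex (_∈ group i) t)

      bit≢0 : ∀ b → bit b ≢ 0 → T b
      bit≢0 true  _ = tt
      bit≢0 false h = ⊥-elim (h refl)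

      T⇒bit≡1 : ∀ b → T b → bit b ≡ 1
      T⇒bit≡1 true _ = refl

      bit-complement : ∀ b → 1 ∸ bit b ≡ 0 → b ≡ true
      bit-complement true _ = refl

      edgeWeight≢0 : ∀ t → edgeWeight entry (mapWalk toℕ t) ≢ 0 → AllEdges (λ u v → T (edge u v)) t
      edgeWeight≢0 (leaf v)     h = tt
      edgeWeight≢0 (node t₁ t₂) h =
        bit≢0 _ (λ bit≡0 → h (cong (_* (e₁ * e₂)) (trans (trans (cong₂ entry (root-map t₁) (root-map t₂)) (edge-entry _ _)) bit≡0))) ,
        edgeWeight≢0 t₁ (λ e₁≡0 → h (trans (cong (λ z → e * (z * e₂)) e₁≡0) (*-zeroʳ e))) ,
        edgeWeight≢0 t₂ (λ e₂≡0 → h (trans (cong (λ z → e * (e₁ * z)) e₂≡0) (trans (cong (e *_) (*-zeroʳ e₁)) (*-zeroʳ e))))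
        where
        e e₁ e₂ : ℕ
        e  = entry (root (mapWalk toℕ t₁)) (root (mapWalk toℕ t₂))
        e₁ = edgeWeight entry (mapWalk toℕ t₁)
        e₂ = edgeWeight entry (mapWalk toℕ t₂)

      edgeWeight≡1 : ∀ t → AllEdges (λ u v → T (edge u v)) t → edgeWeight entry (mapWalk toℕ t) ≡ 1
      edgeWeight≡1 (leaf v)     _             = refl
      edgeWeight≡1 (node t₁ t₂) (r , r₁ , r₂) = cong₂ _*_
        (trans (trans (cong₂ entry (root-map t₁) (root-map t₂)) (edge-entry _ _)) (T⇒bit≡1 _ r))
        (cong₂ _*_ (edgeWeight≡1 t₁ r₁) (edgeWeight≡1 t₂ r₂))

      any-root : ∀ {P : Fin n → Set} t → P (root t) → AnyVertex P t
      any-root (leaf v)     p = p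
      any-root (node t₁ t₂) p = inj₁ (any-root t₁ p)

      avoidance : ∀ i v → 1 ∸ member (toℕ i) (toℕ v) ≡ 0 → v ∈ group i
      avoidance i v h = lookup⇒[]= v (group i) (bit-complement _ (trans (cong (1 ∸_) (sym (group-entry i v))) h))

      presence≡0 : ∀ i v → v ∈ group i → 1 ∸ member (toℕ i) (toℕ v) ≡ 0
      presence≡0 i v v∈ = cong (1 ∸_) (trans (group-entry i v) (cong bit ([]=⇒lookup v∈)))

      missed≡0⇒ : ∀ i t → missed (toℕ i) (mapWalk toℕ t) ≡ 0 → AnyVertex (_∈ group i) t
      missed≡0⇒ i (leaf v)     h = avoidance i v h
      missed≡0⇒ i (node t₁ t₂) h with m*n≡0⇒m≡0∨n≡0 (1 ∸ member (toℕ i) (root (mapWalk toℕ t₁))) h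
      ... | inj₁ root≡0 =
        inj₁ (any-root t₁ (avoidance i (root t₁) (subst (λ r → 1 ∸ member (toℕ i) r ≡ 0) (root-map t₁) root≡0)))
      ... | inj₂ rest≡0 with m*n≡0⇒m≡0∨n≡0 (missed (toℕ i) (mapWalk toℕ t₁)) rest≡0
      ...   | inj₁ m₁≡0 = inj₁ (missed≡0⇒ i t₁ m₁≡0)
      ...   | inj₂ m₂≡0 = inj₂ (missed≡0⇒ i t₂ m₂≡0)

      ⇒missed≡0 : ∀ i t → AnyVertex (_∈ group i) t → missed (toℕ i) (mapWalk toℕ t) ≡ 0
      ⇒missed≡0 i (leaf v)     v∈        = presence≡0 i v v∈
      ⇒missed≡0 i (node t₁ t₂) (inj₁ h) rewrite ⇒missed≡0 i t₁ h = *-zeroʳ (1 ∸ member (toℕ i) (root (mapWalk toℕ t₁)))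
      ⇒missed≡0 i (node t₁ t₂) (inj₂ h) rewrite ⇒missed≡0 i t₂ h | *-zeroʳ (missed (toℕ i) (mapWalk toℕ t₁)) =
        *-zeroʳ (1 ∸ member (toℕ i) (root (mapWalk toℕ t₁)))

      hits≢0 : ∀ j t → hits j t ≢ 0 → ∀ i → i < j → missed i t ≡ 0
      hits≢0 (suc j) t h i i<1+j with i ≟ j
      ... | no i≢j = hits≢0 j t (λ hj≡0 → h (trans (cong ((1 ∸ missed j t) *_) hj≡0) (*-zeroʳ (1 ∸ missed j t)))) i
                       (≤∧≢⇒< (≤-pred i<1+j) i≢j)
      ... | yes refl with missed j t
      ...   | zero  = refl
      ...   | suc m = ⊥-elim (h (cong (_* hits j t) (0∸n≡0 m)))

      hits≡1 : ∀ j t → (∀ i → i < j → missed i t ≡ 0) → hits j t ≡ 1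
      hits≡1 zero    t h = refl
      hits≡1 (suc j) t h rewrite h j ≤-refl = trans (+-identityʳ _) (hits≡1 j t (λ i i<j → h i (m<n⇒m<1+n i<j)))

      total≢0⇒ : total ≢ 0 → ∃[ t ] GoodWalk t
      total≢0⇒ total≢0 with Σ-positive (downFrom n) _ total≢0
      ... | v , v∈ , Σ≢0 with Σ-positive (walks p v) goodTerm Σ≢0
      ...   | t , t∈ , good≢0 with restrict t (All.lookup (walks-bounded p v (∈-downFrom v∈)) t∈)
      ...     | t₀ , refl =
        t₀ , edgeWeight≢0 t₀ edge≢0 , subst (_≤ p) (size-map t₀) (within-≢0 p (size t) within≢0) ,
        (λ i → missed≡0⇒ i t₀ (hits≢0 l t hit≢0 (toℕ i) (toℕ<n i)))
        where
        m w e h : ℕ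
        m = M ^ size t
        w = within p (size t)
        e = edgeWeight entry t
        h = hits l t
        within≢0 : w ≢ 0
        within≢0 eq = good≢0 (cong (_* (e * h)) (trans (cong (m *_) eq) (*-zeroʳ m)))
        edge≢0 : e ≢ 0
        edge≢0 eq = good≢0 (trans (cong (λ z → m * w * (z * h)) eq) (*-zeroʳ (m * w)))
        hit≢0 : h ≢ 0
        hit≢0 eq = good≢0 (trans (cong (λ z → m * w * (e * z)) eq) (trans (cong (m * w *_) (*-zeroʳ e)) (*-zeroʳ (m * w))))

      ⇒total≢0 : ∃[ t ] GoodWalk t → total ≢ 0
      ⇒total≢0 (t₀ , edges , size≤p , groups) total≡0 = <⇒≱ 1≤total (≤-reflexive total≡0)
        where
        t : Walk ℕ
        t = mapWalk toℕ t₀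
        size≤ : size t ≤ p
        size≤ = subst (_≤ p) (sym (size-map t₀)) size≤p
        t∈ : t ∈ˡ walks p (root t)
        t∈ = walks-cover p (root t) t (mapped-< t₀) refl size≤
        hits≡ : hits l t ≡ 1
        hits≡ = hits≡1 l t (λ i i<l → subst (λ j → missed j t ≡ 0) (toℕ-fromℕ< i<l)
          (⇒missed≡0 (fromℕ< i<l) t₀ (groups (fromℕ< i<l))))
        goodTerm≡ : goodTerm t ≡ M ^ size t
        goodTerm≡ rewrite within-≤ size≤ | edgeWeight≡1 t₀ edges | hits≡ =
          trans (*-identityʳ (M ^ size t * 1)) (*-identityʳ (M ^ size t))
        1≤total : 1 ≤ total
        1≤total = begin
          1                                          ≤⟨ m^n>0 M {{>-nonZero 1≤M}} (size t) ⟩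
          M ^ size t                                 ≡⟨ sym goodTerm≡ ⟩
          goodTerm t                                 ≤⟨ term≤Σ goodTerm t∈ ⟩
          Σ (walks p (root t)) goodTerm              ≤⟨ term≤Σ (λ v → Σ (walks p v) goodTerm) (downFrom-∈ (root-all t (mapped-< t₀))) ⟩
          total                                      ∎
          where open ≤-Reasoning

-- Reading the input and computing the powers

module Initialisation (inp : List ℕ) (A B : ℕ) (18≤A : 18 ≤ A) (32≤B : 32 ≤ B) (inp≤B : ∀ i → read inp i ≤ B) where
  open Boxed inp A B 18≤A 32≤B inp≤B

  cap : ℕ
  cap = (read inp 3 ∸ (read inp 3 ∸ read inp 0)) * (1 ∸ read inp 2)

  cap≤ : cap ≤ read inp 3
  cap≤ = ≤-trans (*-monoʳ-≤ (read inp 3 ∸ (read inp 3 ∸ read inp 0)) (m∸n≤m 1 (read inp 2)))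
    (≤-trans (≤-reflexive (*-identityʳ _)) (m∸n≤m (read inp 3) (read inp 3 ∸ read inp 0)))

  readInput-exec : Exec readInput [] (start (read inp 0) (read inp 1) cap) 14
  readInput-exec =
    clear 17 ▹
    set rn (const 0) add (input rRes) (inp≤B 0) ▹
    set rt (const 0) add (const 1) (small 1 _) ▹
    set rl (const 0) add (input rt) (inp≤B 1) ▹
    set rt (const 0) add (const 2) (small 2 _) ▹
    set rh (const 0) add (input rt) (inp≤B 2) ▹
    set rt (const 0) add (const 3) (small 3 _) ▹
    set rp (const 0) add (input rt) (inp≤B 3) ▹
    set rt (reg rp) sub (reg rn) (≤-trans (m∸n≤m (read inp 3) (read inp 0)) (inp≤B 3)) ▹
    set rp (reg rp) sub (reg rt) (≤-trans (m∸n≤m (read inp 3) (read inp 3 ∸ read inp 0)) (inp≤B 3)) ▹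
    set rh (const 1) sub (reg rh) (≤-trans (m∸n≤m 1 (read inp 2)) (small 1 _)) ▹
    set rp (reg rp) mul (reg rh) (≤-trans cap≤ (inp≤B 3)) ▹
    clear rt ▹
    clear rh

  private
    scratch : (n l p N M N-2 u acc t : ℕ) → Memory
    scratch n l p N M N-2 u acc t = regs 0 n l p N M N-2 0 0 0 0 u 0 0 0 acc t 0 []

  powerLoop-exec : ∀ {n l p N M N-2} b u acc → 1 ≤ b → u ≤ B → acc * b ^ u ≤ B →
    Exec (whilenz reg ru loop powerStep)
      (scratch n l p N M N-2 u acc b) (scratch n l p N M N-2 0 (acc * b ^ u) b) (u * 3 + 1)
  powerLoop-exec {n} {l} {p} {N} {M} {N-2} b zero acc 1≤b u≤B h =
    subst (λ z → Exec (whilenz reg ru loop powerStep) (scratch n l p N M N-2 0 acc b) (scratch n l p N M N-2 0 z b) 1)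
      (sym (*-identityʳ acc)) (loop-done refl)
  powerLoop-exec {n} {l} {p} {N} {M} {N-2} b (suc u) acc 1≤b u<B h =
    loop-step 1+n≢0
      (set ru (reg ru) sub (const 1) (<⇒≤ u<B) ▹ set racc (reg racc) mul (reg rt) (≤-trans (m≤m*n (acc * b) (b ^ u) {{>-nonZero b^u>0}}) h′))
      (subst (λ z → Exec (whilenz reg ru loop powerStep) (scratch n l p N M N-2 u (acc * b) b) (scratch n l p N M N-2 0 z b) (u * 3 + 1))
        (*-assoc acc b (b ^ u)) (powerLoop-exec b u (acc * b) 1≤b (<⇒≤ u<B) h′))
    where
    b^u>0 : 1 ≤ b ^ u
    b^u>0 = m^n>0 b {{>-nonZero 1≤b}} u
    h′ : acc * b * b ^ u ≤ B
    h′ = ≤-trans (≤-reflexive (*-assoc acc b (b ^ u))) h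

  power-exec : ∀ {n l p N M N-2 acc} b u → 1 ≤ b → u ≤ B → b ^ u ≤ B →
    Exec power (scratch n l p N M N-2 u acc b) (scratch n l p N M N-2 0 (b ^ u) b) (1 + (u * 3 + 1))
  power-exec {n} {l} {p} {N} {M} {N-2} b u 1≤b u≤B h =
    set racc (const 0) add (const 1) (small 1 _) ▹
    subst (λ z → Exec (whilenz reg ru loop powerStep) (scratch n l p N M N-2 u 1 b) (scratch n l p N M N-2 0 z b) (u * 3 + 1))
      (*-identityˡ (b ^ u)) (powerLoop-exec b u 1 1≤b u≤B (≤-trans (≤-reflexive (*-identityˡ (b ^ u))) h))

  module _ {n l p : ℕ} where

    private
      base M N : ℕ
      base = (n + n) + (n + n)
      M    = base ^ p
      N    = M ^ suc p

    -- The remaining program `Q` is a parameter because the main loop is analysed for the modulus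
    -- `suc c`, whereas the power computed here equals it only by an equation. The equation is
    -- substituted at the point where `Q` takes over.
    initialise-exec : ∀ {c} → suc c ≡ N → 1 ≤ n → base ≤ B → suc p ≤ B → l ≤ B → M ≤ B → N ≤ B → 2 ^ l ≤ B →
      ∀ {Q m k} → Exec Q (regs 0 n l p (suc c) M (c ∸ 1) 0 (2 ^ l) 0 0 0 0 0 0 0 0 0 []) m k →
      Exec (computeBase ⨾ computeModulus ⨾ computeSubsets ⨾ Q) (start n l p) m
        ((3 + (1 + (p * 3 + 1) + 1)) + ((2 + (1 + (suc p * 3 + 1) + 2)) + ((2 + (1 + (l * 3 + 1) + 3)) + k)))
    initialise-exec c≡N 1≤n base≤B p<B l≤B M≤B N≤B 2^l≤B {Q} {m} {k} q =
      (set rt (reg rn) add (reg rn) (≤-trans (m≤m+n (n + n) (n + n)) base≤B) ▹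
       set rt (reg rt) add (reg rt) base≤B ▹
       set ru (const 0) add (reg rp) (<⇒≤ p<B) ▹
       power-exec base p 1≤base (<⇒≤ p<B) M≤B ▹
       set rM (const 0) add (reg racc) M≤B) ▹
      (set rt (const 0) add (reg rM) M≤B ▹
       set ru (const 1) add (reg rp) p<B ▹
       power-exec M (suc p) (m^n>0 base {{>-nonZero 1≤base}} p) p<B N≤B ▹
       set rN (const 0) add (reg racc) N≤B ▹
       set rN-2 (reg rN) sub (const 2) (≤-trans (m∸n≤m N 2) N≤B)) ▹
      (set rt (const 0) add (const 2) (small 2 _) ▹
       set ru (const 0) add (reg rl) l≤B ▹
       power-exec 2 l (s≤s z≤n) l≤B 2^l≤B ▹
       set rx (const 0) add (reg racc) 2^l≤B ▹
       clear racc ▹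
       clear rt) ▹
      subst (λ z → Exec Q (regs 0 n l p z M (z ∸ 2) 0 (2 ^ l) 0 0 0 0 0 0 0 0 0 []) m k) c≡N q
      where
      1≤base : 1 ≤ base
      1≤base = ≤-trans 1≤n (≤-trans (m≤m+n n n) (m≤m+n (n + n) (n + n)))

-- The input

read-++ˡ : ∀ xs ys a → a < length xs → read (xs ++ ys) a ≡ read xs a
read-++ˡ (x ∷ xs) ys zero    _         = refl
read-++ˡ (x ∷ xs) ys (suc a) (s≤s a<) = read-++ˡ xs ys a a<

read-++ʳ : ∀ xs ys a → read (xs ++ ys) (length xs + a) ≡ read ys a
read-++ʳ []       ys a = refl
read-++ʳ (x ∷ xs) ys a = read-++ʳ xs ys a

read-tabulate : ∀ {n} (f : Fin n → ℕ) j → read (tabulate f) (toℕ j) ≡ f j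
read-tabulate f zero    = refl
read-tabulate f (suc j) = read-tabulate (λ i → f (suc i)) j

length-matrix : ∀ {m n} (f : Fin m → Fin n → Bool) → length (matrix f) ≡ m * n
length-matrix {zero}      f = refl
length-matrix {suc m} {n} f = trans (length-++ (tabulate (λ j → bit (f zero j))))
  (cong₂ _+_ (length-tabulate {n = n} (λ j → bit (f zero j))) (length-matrix (λ i → f (suc i))))

read-matrix : ∀ {m n} (f : Fin m → Fin n → Bool) ys i j →
  read (matrix f ++ ys) (toℕ i * n + toℕ j) ≡ bit (f i j)
read-matrix {suc m} {n} f ys i j = trans (cong (λ zs → read zs (toℕ i * n + toℕ j)) (++-assoc row _ ys)) (go i)
  where
  row : List ℕ
  row = tabulate (λ j → bit (f zero j))
  length-row : length row ≡ n
  length-row = length-tabulate (λ j → bit (f zero j))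
  go : ∀ i → read (row ++ (matrix (λ i → f (suc i)) ++ ys)) (toℕ i * n + toℕ j) ≡ bit (f i j)
  go zero    = trans (read-++ˡ row _ (toℕ j) (subst (toℕ j <_) (sym length-row) (toℕ<n j)))
    (read-tabulate (λ j → bit (f zero j)) j)
  go (suc i) = trans (cong (read (row ++ _)) (trans (+-assoc n (toℕ i * n) (toℕ j)) (cong (_+ (toℕ i * n + toℕ j)) (sym length-row))))
    (trans (read-++ʳ row _ (toℕ i * n + toℕ j)) (read-matrix (λ i → f (suc i)) ys i j))

bit≤1 : ∀ b → bit b ≤ 1
bit≤1 true  = ≤-refl
bit≤1 false = z≤n

matrix≤1 : ∀ {m n} (f : Fin m → Fin n → Bool) → All (_≤ 1) (matrix f)
matrix≤1 {zero}  f = []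
matrix≤1 {suc m} f = Allₚ.++⁺ (Allₚ.tabulate⁺ (λ j → bit≤1 (f zero j))) (matrix≤1 (λ i → f (suc i)))

-- Otherwise the logarithm of x would be at least `len x`, which exceeds it by one.
≤2^len : ∀ x → x ≤ 2 ^ len x
≤2^len x with x ≤? 2 ^ len x
... | yes x≤ = x≤
... | no x≰  = ⊥-elim (<⇒≱ (≤-refl {len x})
  (≤-trans (≤-reflexive (sym (⌊log₂[2^n]⌋≡n (len x)))) (⌊log₂⌋-mono-≤ (<⇒≤ (≰⇒> x≰)))))

read-≤-2^totalLen : ∀ xs i → read xs i ≤ 2 ^ totalLen xs
read-≤-2^totalLen []       i       = z≤n
read-≤-2^totalLen (x ∷ xs) zero    = ≤-trans (≤2^len x) (^-monoʳ-≤ 2 (m≤m+n (len x) (totalLen xs)))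
read-≤-2^totalLen (x ∷ xs) (suc i) = ≤-trans (read-≤-2^totalLen xs i) (^-monoʳ-≤ 2 (m≤n+m (totalLen xs) (len x)))

length≤totalLen : ∀ xs → length xs ≤ totalLen xs
length≤totalLen []       = z≤n
length≤totalLen (x ∷ xs) = +-mono-≤ (s≤s z≤n) (length≤totalLen xs)

n≤2^n : ∀ n → n ≤ 2 ^ n
n≤2^n zero    = z≤n
n≤2^n (suc n) = ≤-trans (+-mono-≤ (m^n>0 2 n) (n≤2^n n)) (≤-reflexive (cong (2 ^ n +_) (sym (+-identityʳ _))))

-- Bounds and conclusion

constant≤ : ∀ k {z} → 1 ≤ z → k ≤ k * z
constant≤ k 1≤z = m≤m*n k _ {{>-nonZero 1≤z}}

cube : ℕ → ℕ
cube s = s * (s * s)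

module _ {s : ℕ} (1≤s : 1 ≤ s) where

  s≤s² : s ≤ s * s
  s≤s² = m≤m*n s s {{>-nonZero 1≤s}}

  s²≤s³ : s * s ≤ cube s
  s²≤s³ = *-monoʳ-≤ s s≤s²

  s≤s³ : s ≤ cube s
  s≤s³ = ≤-trans s≤s² s²≤s³

  1≤s² : 1 ≤ s * s
  1≤s² = ≤-trans 1≤s s≤s²

  1≤s³ : 1 ≤ cube s
  1≤s³ = ≤-trans 1≤s s≤s³

  module _ {n l p : ℕ} (n≤s : n ≤ s) (l≤s : l ≤ s) (p≤s : p ≤ s) where

    -- Here and in the next three bounds n, l, p and 1 are replaced by powers of s and the
    -- coefficients are added: 56 = 23 + 10 + 23, 60 = 56 + 4, 108 = 60 + 48 and 157 = 108 + 49.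
    relaxCost-≤ : 2 + (4 + (l * 23 + 1 + 1) + (1 + (n * 10 + 1 + 13))) ≤ 56 * s
    relaxCost-≤ = begin
      2 + (4 + (l * 23 + 1 + 1) + (1 + (n * 10 + 1 + 13))) ≡⟨ expand n l ⟩
      23 * l + 10 * n + 23
        ≤⟨ +-mono-≤ (+-mono-≤ (*-monoʳ-≤ 23 l≤s) (*-monoʳ-≤ 10 n≤s)) (constant≤ 23 1≤s) ⟩
      23 * s + 10 * s + 23 * s                             ≡⟨ collect s ⟩
      56 * s                                               ∎
      where
      open ≤-Reasoning
      expand : ∀ n l → 2 + (4 + (l * 23 + 1 + 1) + (1 + (n * 10 + 1 + 13))) ≡ 23 * l + 10 * n + 23
      expand = solve-∀
      collect : ∀ s → 23 * s + 10 * s + 23 * s ≡ 56 * s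
      collect = solve-∀

    sweepCost-≤ : ∀ {r} → r ≤ 56 * s → 3 + (n * r + 1) ≤ 60 * (s * s)
    sweepCost-≤ {r} r≤ = begin
      3 + (n * r + 1)           ≡⟨ expand (n * r) ⟩
      n * r + 4                 ≤⟨ +-mono-≤ (*-mono-≤ n≤s r≤) (constant≤ 4 1≤s²) ⟩
      s * (56 * s) + 4 * (s * s) ≡⟨ collect s ⟩
      60 * (s * s)              ∎
      where
      open ≤-Reasoning
      expand : ∀ z → 3 + (z + 1) ≡ z + 4
      expand = solve-∀
      collect : ∀ s → s * (56 * s) + 4 * (s * s) ≡ 60 * (s * s)
      collect = solve-∀

    subsetCost-≤ : ∀ {w} → w ≤ 60 * (s * s) →
      2 + (1 + (p * w + 1) + (4 + (l * 23 + 1 + 1) + (2 + (n * 11 + 1 + 1)))) ≤ 108 * cube s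
    subsetCost-≤ {w} w≤ = begin
      2 + (1 + (p * w + 1) + (4 + (l * 23 + 1 + 1) + (2 + (n * 11 + 1 + 1)))) ≡⟨ expand (p * w) n l ⟩
      p * w + (23 * l + 11 * n + 14)
        ≤⟨ +-mono-≤ (*-mono-≤ p≤s w≤) (+-mono-≤ (+-mono-≤ (*-monoʳ-≤ 23 (≤-trans l≤s s≤s³)) (*-monoʳ-≤ 11 (≤-trans n≤s s≤s³))) (constant≤ 14 1≤s³)) ⟩
      s * (60 * (s * s)) + (23 * cube s + 11 * cube s + 14 * cube s) ≡⟨ collect s (cube s) ⟩
      60 * (s * (s * s)) + 48 * cube s ≡⟨ sym (*-distribʳ-+ (cube s) 60 48) ⟩
      108 * cube s ∎
      where
      open ≤-Reasoning
      expand : ∀ z n l → 2 + (1 + (z + 1) + (4 + (l * 23 + 1 + 1) + (2 + (n * 11 + 1 + 1)))) ≡ z + (23 * l + 11 * n + 14)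
      expand = solve-∀
      collect : ∀ s z → s * (60 * (s * s)) + (23 * z + 11 * z + 14 * z) ≡ 60 * (s * (s * s)) + 48 * z
      collect = solve-∀

    programCost-≤ : ∀ {x q} → 1 ≤ x → q ≤ 108 * cube s →
      14 + suc ((3 + (1 + (p * 3 + 1) + 1)) + ((2 + (1 + (suc p * 3 + 1) + 2)) + ((2 + (1 + (l * 3 + 1) + 3)) +
        ((x * q + 1) + 2)))) ≤ x * (157 * cube s)
    programCost-≤ {x} {q} 1≤x q≤ = begin
      14 + suc ((3 + (1 + (p * 3 + 1) + 1)) + ((2 + (1 + (suc p * 3 + 1) + 2)) + ((2 + (1 + (l * 3 + 1) + 3)) +
        ((x * q + 1) + 2)))) ≡⟨ expand p l (x * q) ⟩
      x * q + (6 * p + 3 * l + 40)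
        ≤⟨ +-mono-≤ (*-monoʳ-≤ x q≤) (+-mono-≤ (+-mono-≤ (*-monoʳ-≤ 6 (≤-trans p≤s s≤s³)) (*-monoʳ-≤ 3 (≤-trans l≤s s≤s³))) (constant≤ 40 1≤s³)) ⟩
      x * (108 * cube s) + (6 * cube s + 3 * cube s + 40 * cube s)
        ≤⟨ +-monoʳ-≤ (x * (108 * cube s)) (≤-trans (≤-reflexive (collect (cube s))) (m≤n*m (49 * cube s) x {{>-nonZero 1≤x}})) ⟩
      x * (108 * cube s) + x * (49 * cube s) ≡⟨ sym (*-distribˡ-+ x (108 * cube s) (49 * cube s)) ⟩
      x * (108 * cube s + 49 * cube s) ≡⟨ cong (x *_) (sym (*-distribʳ-+ (cube s) 108 49)) ⟩
      x * (157 * cube s) ∎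
      where
      open ≤-Reasoning
      expand : ∀ p l z → 14 + suc ((3 + (1 + (p * 3 + 1) + 1)) + ((2 + (1 + (suc p * 3 + 1) + 2)) + ((2 + (1 + (l * 3 + 1) + 3)) +
        ((z + 1) + 2)))) ≡ z + (6 * p + 3 * l + 40)
      expand = solve-∀
      collect : ∀ z → 6 * z + 3 * z + 40 * z ≡ 49 * z
      collect = solve-∀

  -- The left side is the length of the value bound B chosen in `Decide`.
  exponent-≤ : 1 + 3 * ((2 + s) * (s * s)) ≤ 10 * cube s
  exponent-≤ = begin
    1 + 3 * ((2 + s) * (s * s))          ≤⟨ +-mono-≤ 1≤s³ (*-monoʳ-≤ 3 (*-monoˡ-≤ (s * s) (+-monoˡ-≤ s (*-monoʳ-≤ 2 1≤s)))) ⟩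
    cube s + 3 * ((2 * s + s) * (s * s)) ≡⟨ collect s ⟩
    10 * cube s                          ∎
    where
    open ≤-Reasoning
    collect : ∀ s → s * (s * s) + 3 * ((2 * s + s) * (s * s)) ≡ 10 * (s * (s * s))
    collect = solve-∀

  space-≤ : ∀ {n L} → 4 + n ≤ s → L ≤ 10 * cube s → (18 + n) * L ≤ 150 * s ^ 4
  space-≤ 4+n≤s L≤ =
    ≤-trans (*-mono-≤ (≤-trans (+-monoʳ-≤ 14 4+n≤s) (+-monoˡ-≤ s (constant≤ 14 1≤s))) L≤) (≤-reflexive (collect s))
    where
    collect : ∀ s → (14 * s + s) * (10 * (s * (s * s))) ≡ 150 * (s * (s * (s * (s * 1))))
    collect = solve-∀

-- There are x · k · s³ units of cost 8 L each. Of the exponent 6, one half counts units and the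
-- other half is the length of the numbers; 80 = 8 · 10.
time-≤ : ∀ {x s L} k → L ≤ 10 * cube s → x * (k * cube s) * (8 * L) ≤ 80 * k * (x * s ^ 6)
time-≤ {x} {s} k L≤ = ≤-trans (*-monoʳ-≤ (x * (k * cube s)) (*-monoʳ-≤ 8 L≤)) (≤-reflexive (collect x s k))
  where
  collect : ∀ x s k → x * (k * (s * (s * s))) * (8 * (10 * (s * (s * s)))) ≡ 80 * k * (x * (s * (s * (s * (s * (s * (s * 1)))))))
  collect = solve-∀

-- Steiner trees and covering walks

module WalksOfInstance (I : Instance) where
  open Instance I

  -- min (p, order), or 0 when p is negative.
  cap : ℕ
  cap = (ℤ.∣ p ∣ ∸ (ℤ.∣ p ∣ ∸ order)) * (1 ∸ signBit p)

  capped-≥ : ∀ {q} P → q ≤ P → q ≤ order → q ≤ P ∸ (P ∸ order)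
  capped-≥ {q} P q≤P q≤n with ≤-total P order
  ... | inj₁ P≤n rewrite m≤n⇒m∸n≡0 P≤n = q≤P
  ... | inj₂ n≤P rewrite m∸[m∸n]≡n n≤P = q≤n

  ≤p⇒≤cap : ∀ {q} r → 1 ≤ q → q ≤ order → ℤ.+ q ℤ.≤ r → q ≤ (ℤ.∣ r ∣ ∸ (ℤ.∣ r ∣ ∸ order)) * (1 ∸ signBit r)
  ≤p⇒≤cap (ℤ.+ P)    1≤q q≤n q≤P = ≤-trans (capped-≥ P (drop‿+≤+ q≤P) q≤n) (≤-reflexive (sym (*-identityʳ _)))
  ≤p⇒≤cap -[1+ k ] 1≤q q≤n ()

  ≤cap⇒≤p : ∀ {q} r → 1 ≤ q → q ≤ (ℤ.∣ r ∣ ∸ (ℤ.∣ r ∣ ∸ order)) * (1 ∸ signBit r) → ℤ.+ q ℤ.≤ r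
  ≤cap⇒≤p (ℤ.+ P)    1≤q q≤ = +≤+ (≤-trans q≤ (≤-trans (≤-reflexive (*-identityʳ _)) (m∸n≤m P (P ∸ order))))
  ≤cap⇒≤p -[1+ k ] 1≤q q≤ = ⊥-elim (<⇒≱ 1≤q (≤-trans q≤ (≤-reflexive (*-zeroʳ (suc k ∸ (suc k ∸ order))))))

  cap≤order : cap ≤ order
  cap≤order = ≤-trans (*-monoʳ-≤ (ℤ.∣ p ∣ ∸ (ℤ.∣ p ∣ ∸ order)) (m∸n≤m 1 (signBit p)))
    (≤-trans (≤-reflexive (*-identityʳ _)) (capped-≤ ℤ.∣ p ∣))
    where
    capped-≤ : ∀ P → P ∸ (P ∸ order) ≤ order
    capped-≤ P with ≤-total P order
    ... | inj₁ P≤n = ≤-trans (m∸n≤m P (P ∸ order)) P≤n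
    ... | inj₂ n≤P = ≤-reflexive (m∸[m∸n]≡n n≤P)

  CoveringWalk : Walk (Fin order) → Set
  CoveringWalk t = AllEdges (λ u v → T (Graph.edge graph u v)) t × size t ≤ cap × (∀ i → AnyVertex (_∈ group i) t)

  nonempty-size : ∀ {n} {S : Subset n} → Nonempty S → 1 ≤ ∣ S ∣
  nonempty-size {S = S} (x , x∈) = subst (_≤ ∣ S ∣) (∣⁅x⁆∣≡1 x)
    (p⊆q⇒∣p∣≤∣q∣ (λ y∈ → subst (_∈ S) (sym (x∈⁅y⁆⇒x≡y x y∈)) x∈))

  tree⇒walk : HasGroupSteinerTree I → ∃[ t ] CoveringWalk t
  tree⇒walk (H , (nonempty , connected , _) , size≤p , meets)
    with walk-through H connected nonempty
  ... | t , edges , size≤ , covers =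
    t , edges-map (Subgraph.edge⊆ H) t edges ,
    ≤-trans size≤ (≤p⇒≤cap p (nonempty-size nonempty) (∣p∣≤n (Subgraph.verts H)) size≤p) ,
    λ i → let v , v∈ = meets i
              v∈H , v∈group = x∈p∩q⁻ (Subgraph.verts H) (group i) v∈
          in any-vertex t (covers v v∈H) v∈group

  walk⇒tree : ∃[ t ] CoveringWalk t → HasGroupSteinerTree I
  walk⇒tree (t , edges , size≤ , meets) with tree-of-walk t edges
  ... | H , tree , contained , card =
    H , tree , ≤cap⇒≤p p (nonempty-size (proj₁ tree)) (≤-trans card size≤) ,
    λ i → let v , v∈H , v∈group = common-vertex t contained (meets i) in v , x∈p∩q⁺ (v∈H , v∈group)

-- Choice of the bounds and the decision

module Decide (I : Instance) where
  open Instance I using (order; graph; l; group)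
  open WalksOfInstance I

  inp : List ℕ
  inp = encode I

  -- 4n is at most 2 ^ (2 + s), and N is its power with exponent cap · (cap + 1), which is at most
  -- s². The factor 3 makes room for N³.
  s E B : ℕ
  s = inputSize I
  E = 3 * ((2 + s) * (s * s))
  B = 2 ^ E

  incidence : Fin l → Fin order → Bool
  incidence i v = lookup (group i) v

  4+size≤s : 4 + (order + l) * order ≤ s
  4+size≤s = ≤-trans (≤-reflexive (cong (_+_ 4) (sym (trans (length-++ (matrix (Graph.edge graph)))
    (trans (cong₂ _+_ (length-matrix (Graph.edge graph)) (length-matrix incidence)) (sym (*-distribʳ-+ order order l)))))))
    (length≤totalLen inp)

  4≤s : 4 ≤ s
  4≤s = ≤-trans (m≤m+n 4 _) 4+size≤s

  1≤s : 1 ≤ s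
  1≤s = ≤-trans (s≤s z≤n) 4≤s

  4+order≤s : 4 + order ≤ s
  4+order≤s = ≤-trans (+-monoʳ-≤ 4 (square order)) 4+size≤s
    where
    square : ∀ m → m ≤ (m + l) * m
    square zero    = z≤n
    square (suc m) = m≤n*m (suc m) (suc m + l)

  order≤s : order ≤ s
  order≤s = ≤-trans (m≤n+m order 4) 4+order≤s

  16[2+s]≤E : 16 * (2 + s) ≤ E
  16[2+s]≤E = ≤-trans (≤-trans (≤-reflexive (*-comm 16 (2 + s))) (*-monoʳ-≤ (2 + s) (*-mono-≤ 4≤s 4≤s))) (m≤n*m ((2 + s) * (s * s)) 3)

  14+s≤E : 14 + s ≤ E
  14+s≤E = ≤-trans (+-mono-≤ {14} {32} (m≤m+n 14 18) (m≤n*m s 16)) (≤-trans (≤-reflexive (sym (*-distribˡ-+ 16 2 s))) 16[2+s]≤E)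

  E≤B : E ≤ B
  E≤B = n≤2^n E

  s≤E : s ≤ E
  s≤E = ≤-trans (m≤n+m s 14) 14+s≤E

  s≤B : s ≤ B
  s≤B = ≤-trans s≤E E≤B

  32≤B : 32 ≤ B
  32≤B = ≤-trans (≤-trans (≤-trans (m≤m+n 32 (16 * s)) (≤-reflexive (sym (*-distribˡ-+ 16 2 s)))) 16[2+s]≤E) E≤B

  inp≤B : ∀ i → read inp i ≤ B
  inp≤B i = ≤-trans (read-≤-2^totalLen inp i) (^-monoʳ-≤ 2 s≤E)

  cells≤B : 18 + order ≤ B
  cells≤B = ≤-trans (+-monoʳ-≤ 14 4+order≤s) (≤-trans 14+s≤E E≤B)

  index≤B : 4 + (order + l) * order ≤ B
  index≤B = ≤-trans 4+size≤s s≤B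

  bits≤1 : ∀ i → read inp (4 + i) ≤ 1
  bits≤1 = read-≤ (Allₚ.++⁺ (matrix≤1 (Graph.edge graph)) (matrix≤1 incidence))

  edge-entry : ∀ u v → read inp (4 + (toℕ u * order + toℕ v)) ≡ bit (Graph.edge graph u v)
  edge-entry u v = read-matrix (Graph.edge graph) (matrix incidence) u v

  group-entry : ∀ i v → read inp (4 + ((order + toℕ i) * order + toℕ v)) ≡ bit (incidence i v)
  group-entry i v = trans (cong (read (matrix (Graph.edge graph) ++ matrix incidence)) address)
    (trans (read-++ʳ (matrix (Graph.edge graph)) (matrix incidence) _)
      (trans (cong (λ xs → read xs (toℕ i * order + toℕ v)) (sym (++-identityʳ (matrix incidence))))
        (read-matrix incidence [] i v)))
    where
    address : (order + toℕ i) * order + toℕ v ≡ length (matrix (Graph.edge graph)) + (toℕ i * order + toℕ v)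
    address = trans (cong (_+ toℕ v) (*-distribʳ-+ order order (toℕ i)))
      (trans (+-assoc (order * order) _ _) (cong (_+ (toℕ i * order + toℕ v)) (sym (length-matrix (Graph.edge graph)))))

  open Boxed inp (18 + order) B (m≤m+n 18 order) 32≤B inp≤B
  open Initialisation inp (18 + order) B (m≤m+n 18 order) 32≤B inp≤B hiding (cap)

  Decided : Memory → Set
  Decided m = (HasGroupSteinerTree I ⇔ read m 0 ≡ 1)

  Outcome : Set
  Outcome = ∃[ m ] (Exec program [] m (2 ^ l * (157 * cube s)) × Decided m)

  1≤2^l : 1 ≤ 2 ^ l
  1≤2^l = m^n>0 2 l

  zero-cap : cap ≡ 0 → Outcome
  zero-cap cap≡0 = _ , weaken cost (readInput-exec ▹ branch-zero cap≡0 pass) , mk⇔ impossible λ ()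
    where
    cost : 16 ≤ 2 ^ l * (157 * cube s)
    cost = *-mono-≤ 1≤2^l (*-mono-≤ {16} {157} (m≤m+n 16 141) (1≤s³ 1≤s))
    impossible : HasGroupSteinerTree I → 0 ≡ 1
    impossible tree with tree⇒walk tree
    ... | t , _ , size≤ , _ = ⊥-elim (<⇒≱ (1≤size t) (≤-trans size≤ (≤-reflexive cap≡0)))

  module PositiveCap (1≤cap : 1 ≤ cap) where

    1≤order : 1 ≤ order
    1≤order = ≤-trans 1≤cap cap≤order

    -- A vertex is essential here: without one the incidence matrix is empty and l, written in
    -- binary, may be exponential in s. In that case the cap is 0 and the program stops before any
    -- loop over the groups.
    l≤s : l ≤ s
    l≤s = ≤-trans (≤-trans (≤-trans (m≤n+m l order) (m≤m*n (order + l) order {{>-nonZero 1≤order}})) (m≤n+m _ 4)) 4+size≤s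

    D M N c : ℕ
    D = Families.D order
    M = D ^ cap
    N = M ^ suc cap
    c = pred N

    4≤D : 4 ≤ D
    4≤D = +-mono-≤ (+-mono-≤ 1≤order 1≤order) (+-mono-≤ 1≤order 1≤order)

    1≤D : 1 ≤ D
    1≤D = ≤-trans (s≤s z≤n) 4≤D

    order≤D : order ≤ D
    order≤D = ≤-trans (m≤m+n order order) (m≤m+n (order + order) (order + order))

    D≤M : D ≤ M
    D≤M = ≤-trans (≤-reflexive (sym (*-identityʳ D))) (^-monoʳ-≤ D {{>-nonZero 1≤D}} 1≤cap)

    1≤M : 1 ≤ M
    1≤M = ≤-trans 1≤D D≤M

    M<N : M < N
    M<N = begin-strict
      M                <⟨ m<m+n M 1≤M ⟩
      M + M            ≡⟨ cong (_+_ M) (sym (+-identityʳ M)) ⟩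
      2 * M            ≤⟨ *-monoˡ-≤ M (≤-trans (s≤s (s≤s z≤n)) (≤-trans 4≤D D≤M)) ⟩
      M * M            ≡⟨ cong (_*_ M) (sym (*-identityʳ M)) ⟩
      M ^ 2            ≤⟨ ^-monoʳ-≤ M {{>-nonZero 1≤M}} (s≤s 1≤cap) ⟩
      N                ∎
      where open ≤-Reasoning

    1≤N : 1 ≤ N
    1≤N = ≤-trans 1≤M (<⇒≤ M<N)

    c≡ : suc c ≡ N
    c≡ = suc-pred N {{>-nonZero 1≤N}}

    M≤c : M ≤ c
    M≤c = ≤-pred (subst (M <_) (sym c≡) M<N)

    cap<s : suc cap ≤ s
    cap<s = ≤-trans (s≤s cap≤order) (≤-trans (m≤n+m (suc order) 3) 4+order≤s)

    N≤2^ : N ≤ 2 ^ ((2 + s) * (s * s))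
    N≤2^ = begin
      (D ^ cap) ^ suc cap                ≡⟨ ^-*-assoc D cap (suc cap) ⟩
      D ^ (cap * suc cap)                ≤⟨ ^-monoˡ-≤ (cap * suc cap) D≤ ⟩
      (2 ^ (2 + s)) ^ (cap * suc cap)    ≡⟨ ^-*-assoc 2 (2 + s) (cap * suc cap) ⟩
      2 ^ ((2 + s) * (cap * suc cap))    ≤⟨ ^-monoʳ-≤ 2 (*-monoʳ-≤ (2 + s) (*-mono-≤ (<⇒≤ cap<s) cap<s)) ⟩
      2 ^ ((2 + s) * (s * s))            ∎
      where
      open ≤-Reasoning
      four : ∀ n → (n + n) + (n + n) ≡ 2 * (2 * n)
      four = solve-∀
      D≤ : D ≤ 2 ^ (2 + s)
      D≤ = ≤-trans (≤-reflexive (four order)) (*-monoʳ-≤ 2 (*-monoʳ-≤ 2 (≤-trans order≤s (n≤2^n s))))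

    N³≤B : N * N * N ≤ B
    N³≤B = ≤-trans (≤-reflexive (trans (*-assoc N N N) (cong (λ z → N * (N * z)) (sym (*-identityʳ N)))))
      (≤-trans (^-monoˡ-≤ 3 N≤2^) (≤-reflexive (trans (^-*-assoc 2 ((2 + s) * (s * s)) 3) (cong (2 ^_) (*-comm ((2 + s) * (s * s)) 3)))))

    N≤B : N ≤ B
    N≤B = ≤-trans N≤2^ (^-monoʳ-≤ 2 (m≤n*m ((2 + s) * (s * s)) 3))

    module A = Algo inp order l cap c M B 32≤B inp≤B bits≤1 1≤order
      (≤-trans order≤D (≤-trans D≤M M≤c)) M≤c (≤-trans 1≤M M≤c)
      (subst (λ z → z * z * z ≤ B) (sym c≡) N³≤B) index≤B cells≤B
    module C = A.Correctness refl c≡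
    module W = C.Decision (Graph.edge graph) group edge-entry group-entry

    cost : 14 + suc ((3 + (1 + (cap * 3 + 1) + 1)) + ((2 + (1 + (suc cap * 3 + 1) + 2)) + ((2 + (1 + (l * 3 + 1) + 3)) +
        ((2 ^ l * suc A.subsetCost + 1) + 2)))) ≤ 2 ^ l * (157 * cube s)
    cost = programCost-≤ 1≤s order≤s l≤s (<⇒≤ cap<s) 1≤2^l
      (subsetCost-≤ 1≤s order≤s l≤s (<⇒≤ cap<s)
        (sweepCost-≤ 1≤s order≤s l≤s (<⇒≤ cap<s) (relaxCost-≤ 1≤s order≤s l≤s (<⇒≤ cap<s))))

    finish : ∀ {m} →
      Exec (ifnz reg rtot then reg rRes ← const 1 else skip)
        (A.st (A.subsetsTotal (2 ^ l) [] 0) 0 0 0 0 0 0 0 0 0 0 (A.subsetsMemory (2 ^ l) [])) m 2 →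
      Exec program [] m (2 ^ l * (157 * cube s))
    finish last = weaken cost
      (readInput-exec ▹ branch-nonzero (λ cap≡0 → <⇒≱ 1≤cap (≤-reflexive cap≡0))
        (initialise-exec c≡ 1≤order (≤-trans D≤M (≤-trans (<⇒≤ M<N) N≤B)) (≤-trans cap<s s≤B) (≤-trans l≤s s≤B)
          (≤-trans (<⇒≤ M<N) N≤B) N≤B 2^l≤B
          (A.subsetsLoop-exec (2 ^ l) (≤-trans (<⇒≤ cap<s) s≤B) z≤n 2^l≤B [] ▹ last)))
      where
      2^l≤B : 2 ^ l ≤ B
      2^l≤B = ^-monoʳ-≤ 2 (≤-trans l≤s s≤E)

    total : ℕ
    total = A.subsetsTotal (2 ^ l) [] 0

    outcome : Dec (total ≡ 0) → Outcome
    outcome (yes total≡0) = _ , finish (branch-zero total≡0 pass) ,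
      mk⇔ (λ tree → ⊥-elim (W.⇒total≢0 (tree⇒walk tree) (trans (sym C.subsetsTotal-≡) total≡0))) (λ ())
    outcome (no total≢0) = _ , finish (branch-nonzero total≢0 (set rRes (const 0) add (const 1) (small 1 _))) ,
      mk⇔ (λ _ → refl) (λ _ → walk⇒tree (W.total≢0⇒ (λ total≡0 → total≢0 (trans C.subsetsTotal-≡ total≡0))))

  outcome : Dec (cap ≡ 0) → Outcome
  outcome (yes cap≡0) = zero-cap cap≡0
  outcome (no cap≢0)  = PositiveCap.outcome 1≤cap (PositiveCap.total 1≤cap ≟ 0)
    where
    1≤cap : 1 ≤ cap
    1≤cap = n≢0⇒n>0 cap≢0

  len-B≤ : len B ≤ 10 * cube s
  len-B≤ = ≤-trans (≤-reflexive (cong suc (⌊log₂[2^n]⌋≡n E))) (exponent-≤ 1≤s)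

lemma3 : ∃[ P ] ∃[ a ] ∃[ b ] ∃[ c ] ∃[ d ] ((I : Instance) →
    ∃[ m ] ∃[ t ] ∃[ s ]
    ( Run (encode I) P [] m t s
    × (HasGroupSteinerTree I ⇔ read m 0 ≡ 1)
    × t ≤ a * (2 ^ Instance.l I * inputSize I ^ b)
    × s ≤ c * inputSize I ^ d ))
lemma3 = program , 80 * 157 , 6 , 150 , 4 , λ I →
  let open Decide I
      m , execution , decided = outcome (WalksOfInstance.cap I ≟ 0)
      t , s , run , t≤ , s≤ , _ = Boxed.Exec.run execution ([] , z≤n)
  in m , t , s , run , decided , ≤-trans t≤ (time-≤ {2 ^ Instance.l I} {inputSize I} 157 len-B≤) , ≤-trans s≤ (space-≤ 1≤s 4+order≤s len-B≤)
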